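{- Let $p\ge q\ge 1$ be integers. The packing orbitope $O^{\le}_{p,q}\subseteq\mathbb{R}^{\mathcal{I}_{p,q}}$ is the orthogonal projection to the space $\mathbb{R}^{\mathcal{I}_{p,q}}$ (i.e., the image under $(x,y)\mapsto x$) of the polytope $$P_{p,q}=\{(x,y)\in\mathbb{R}^{\mathcal{I}_{p,q}}\times\mathbb{R}^{A_{p,q}} : y\in F_{p,q},\ (x,y)\text{ satisfies (a) and (b)}\},$$ where (a) is $y_{(i-1,j-1)^{\searrow}}\le x_{ij}$ for all $(i,j)\in\mathcal{I}_{p,q}$, and (b) is $x(\mathrm{bar}_{i,j})\le y(\mathrm{in}^{\searrow}(\mathrm{col}_{i,j}))$ for all $(i,j)\in\mathcal{I}_{p,q}$.
   Context: Notation: $[n]=\{1,\dots,n\}$, $[n]_0=\{0,1,\dots,n\}$, $q(i)=\min\{i,q\}$, $\mathcal{I}_{p,q}=\{(i,j)\in[p]\times[q] : i\ge j\}$. For a vector $z\in\mathbb{R}^M$ and $N\subseteq M$, $z(N)=\sum_{e\in N}z_e$. The packing orbitope $O^{\le}_{p,q}$ is the convex hull of all 0/1-matrices of size $p\times q$ whose columns are in lexicographically decreasing (i.e., non-increasing, with row 1 the most significant position) order and that have at most one 1-entry per row. Since no such matrix has a 1 above its main diagonal, the entries $(i,j)$ with $i<j$ are dropped and $O^{\le}_{p,q}$ is regarded as a subset of $\mathbb{R}^{\mathcal{I}_{p,q}}$. The directed acyclic graph $D_{p,q}=(V_{p,q},A_{p,q})$ has node set $V_{p,q}=\mathcal{I}_{p,q}\uplus([p]_0\times\{0\})\uplus\{s\}\uplus\{t\}$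 and the following arcs: - vertical arcs $(i,j)^{\downarrow}=((i,j),(i+1,j))$ for $i\in[p-1]_0$, $j\in[q(i)]_0$; - diagonal arcs $(i,j)^{\searrow}=((i,j),(i+1,j+1))$ for $i\in[p-1]_0$, $j\in[q(i+1)-1]_0$; - the arc $(s,(0,0))$; - the arcs $((p,j),t)$ for $j\in[q]_0$. $F_{p,q}\subseteq\mathbb{R}^{A_{p,q}}$ is the set of all $s$-$t$-flows in $D_{p,q}$ of flow value one without capacity restrictions: $y\ge 0$, flow conservation at every node other than $s,t$, and one unit of flow leaving $s$. For $W\subseteq V_{p,q}$, $\mathrm{in}^{\searrow}(W)$ is the set of diagonal arcs $(u,w)$ with $w\in W$, $u\notin W$. For $(i,j)\in\mathcal{I}_{p,q}$: $\mathrm{bar}_{i,j}=\{(i,\ell)\in\mathcal{I}_{p,q} : \ell\ge j\}$ and $\mathrm{col}_{i,j}=\{(k,j) : j\le k\le i\}$. -}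

module Defs where

open import Algebra.Bundles using (CommutativeRing)
open import Data.Bool.Base as Bool using (Bool; true; if_then_else_)
open import Data.Empty using (⊥)
open import Data.Unit.Base using (⊤; tt)
open import Data.Fin.Base as Fin using (Fin; toℕ; fromℕ; inject₁)
import Data.Fin.Properties as Fin
open import Data.List.Base as List
  using (List; []; _∷_; _++_; map; filter; foldr; allFin; cartesianProduct)
open import Data.List.Membership.Propositional using (_∈_)
import Data.List.Membership.Propositional.Properties as ∈
import Data.List.Relation.Unary.All as All
open import Data.List.Relation.Unary.All using (All; []; _∷_)
open import Data.List.Relation.Unary.AllPairs using ([]; _∷_)
open import Data.List.Relation.Unary.Any using (here; there)
open import Data.List.Relation.Unary.Unique.Propositional using (Unique)
import Data.List.Relation.Unary.Unique.Propositional.Properties as Unique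
open import Data.Nat.Base using (ℕ; suc; _≤_; s≤s)
import Data.Nat.Properties as ℕ
open import Data.Product.Base using (Σ; ∃; _×_; _,_; proj₂)
open import Data.Sum.Base using (inj₁; inj₂)
open import Data.Vec.Base as Vec using (Vec)
open import Data.Vec.Relation.Binary.Lex.NonStrict using (Lex-≤)
open import Level using (Level; 0ℓ; _⊔_) renaming (suc to lsuc)
open import Relation.Binary.Core using (Rel)
open import Relation.Binary.Definitions using (DecidableEquality)
open import Relation.Binary.PropositionalEquality
  using (_≡_; _≢_; refl; sym; cong)
open import Relation.Binary.Structures using (IsDecTotalOrder)
open import Relation.Nullary using (¬_; yes; no)
open import Relation.Nullary.Decidable using (_×-dec_; ¬?)
open import Relation.Nullary.Negation using (contradiction-irr)
open import Relation.Unary using (Pred; Decidable)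

-- ℝ is the motivating instance; being a classical ordered field, it has a
-- decidable order.  Completeness is not assumed.
record OrderedField (c ℓ₁ ℓ₂ : Level) : Set (lsuc (c ⊔ ℓ₁ ⊔ ℓ₂)) where
  infix 4 _≼_
  field
    commutativeRing : CommutativeRing c ℓ₁
  open CommutativeRing commutativeRing public
    using (Carrier; _≈_; _+_; _*_; -_; 0#; 1#; +-commutativeMonoid)
  field
    _≼_             : Rel Carrier ℓ₂
    isDecTotalOrder : IsDecTotalOrder _≈_ _≼_
    +-monoˡ-≼       : ∀ z {x y} → x ≼ y → x + z ≼ y + z
    *-nonNegative   : ∀ {x y} → 0# ≼ x → 0# ≼ y → 0# ≼ x * y
    0≉1             : ¬ (0# ≈ 1#)
    invertible      : ∀ x → ¬ (x ≈ 0#) → ∃ λ y → x * y ≈ 1#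

record Finite (E : Set) : Set where
  field
    elements : List E
    complete : ∀ e → e ∈ elements
    unique   : Unique elements

-- Pairs (i , j) in {0,…,m-1} × {0,…,n-1} with j ≤ i.
record Staircase (m n : ℕ) : Set where
  constructor ⟨_,_⟩[_]
  field
    row      : Fin m
    col      : Fin n
    .col≤row : toℕ col ≤ toℕ row

open Staircase public using (row; col)

module _ {m n : ℕ} where

  staircase-≡ : {u v : Staircase m n} → row u ≡ row v → col u ≡ col v → u ≡ v
  staircase-≡ refl refl = refl

  _≟-staircase_ : DecidableEquality (Staircase m n)
  u ≟-staircase v with row u Fin.≟ row v | col u Fin.≟ col v
  ... | yes r | yes c = yes (staircase-≡ r c)
  ... | no ¬r | _     = no λ e → ¬r (cong row e)
  ... | yes _ | no ¬c = no λ e → ¬c (cong col e)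

  staircases : List (Fin m × Fin n) → List (Staircase m n)
  staircases [] = []
  staircases ((i , j) ∷ ps) with toℕ j ℕ.≤? toℕ i
  ... | yes j≤i = ⟨ i , j ⟩[ j≤i ] ∷ staircases ps
  ... | no  _   = staircases ps

  ∈-staircases⁺ : ∀ (u : Staircase m n) {ps} →
                  (row u , col u) ∈ ps → u ∈ staircases ps
  ∈-staircases⁺ ⟨ i , j ⟩[ h ] {_ ∷ _} (here refl) with toℕ j ℕ.≤? toℕ i
  ... | yes _   = here refl
  ... | no  j≰i = contradiction-irr h j≰i
  ∈-staircases⁺ u {(i , j) ∷ _} (there u∈) with toℕ j ℕ.≤? toℕ i
  ... | yes _ = there (∈-staircases⁺ u u∈)
  ... | no  _ = ∈-staircases⁺ u u∈

  staircases-All : ∀ {p} {P : Pred (Fin m × Fin n) p} {ps} → All P ps →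
                   All (λ u → P (row u , col u)) (staircases ps)
  staircases-All [] = []
  staircases-All {ps = (i , j) ∷ _} (px ∷ pxs) with toℕ j ℕ.≤? toℕ i
  ... | yes _ = px ∷ staircases-All pxs
  ... | no  _ = staircases-All pxs

  staircases-unique : ∀ {ps} → Unique ps → Unique (staircases ps)
  staircases-unique [] = []
  staircases-unique {(i , j) ∷ _} (p∉ ∷ uniq) with toℕ j ℕ.≤? toℕ i
  ... | yes _ = All.map (λ {u} ≢u e → ≢u (cong (λ v → row v , col v) {y = u} e))
                        (staircases-All {P = (i , j) ≢_} p∉)
                ∷ staircases-unique uniq
  ... | no  _ = staircases-unique uniq

staircase-finite : ∀ m n → Finite (Staircase m n)
staircase-finite m n = record
  { elements = staircases (cartesianProduct (allFin m) (allFin n))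
  ; complete = λ u → ∈-staircases⁺ u
      (∈.∈-cartesianProduct⁺ (∈.∈-allFin (row u)) (∈.∈-allFin (col u)))
  ; unique   = staircases-unique
      (Unique.cartesianProduct⁺ (Unique.allFin⁺ m) (Unique.allFin⁺ n))
  }

-- ⟨ i , j ⟩ : ℐ p q stands for the 1-based pair (i+1 , j+1).

ℐ : ℕ → ℕ → Set
ℐ p q = Staircase p q

bar : ∀ {p q} → ℐ p q → Pred (ℐ p q) 0ℓ
bar e f = row f ≡ row e × toℕ (col e) ≤ toℕ (col f)

bar? : ∀ {p q} (e : ℐ p q) → Decidable (bar e)
bar? e f = (row f Fin.≟ row e) ×-dec (toℕ (col e) ℕ.≤? toℕ (col f))

01-Matrix : ℕ → ℕ → Set
01-Matrix p q = Fin p → Fin q → Bool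

module _ {p q : ℕ} (M : 01-Matrix p q) where

  column : Fin q → Vec Bool p
  column j = Vec.tabulate (λ i → M i j)

  LexDecreasingColumns : Set
  LexDecreasingColumns =
    ∀ {j k} → j Fin.< k → Lex-≤ _≡_ Bool._≤_ (column k) (column j)

  AtMostOneOnePerRow : Set
  AtMostOneOnePerRow = ∀ i {j k} → M i j ≡ true → M i k ≡ true → j ≡ k

-- Here coordinates are not shifted: grid ⟨ i , j ⟩ is the node (i , j) with
-- 0 ≤ i ≤ p and 0 ≤ j ≤ min(i , q), so the nodes with j ≥ 1 form the copy of
-- the index set and those with j = 0 form the additional column.

data Node (p q : ℕ) : Set where
  grid : Staircase (suc p) (suc q) → Node p q
  s t  : Node p q

-- down ⟨ i , j ⟩ and diag ⟨ i , j ⟩ are the vertical and the diagonal arc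
-- with tail (i , j); their ranges are 0 ≤ i ≤ p-1 with j ≤ min(i , q) and
-- j ≤ min(i+1 , q) - 1 respectively.

data Arc (p q : ℕ) : Set where
  down  : Staircase p (suc q) → Arc p q
  diag  : Staircase p q → Arc p q
  start : Arc p q
  end   : Fin (suc q) → Arc p q

module _ {p q : ℕ} where

  _≟-node_ : DecidableEquality (Node p q)
  grid u ≟-node grid v with u ≟-staircase v
  ... | yes refl = yes refl
  ... | no  u≢v  = no λ { refl → u≢v refl }
  grid _ ≟-node s      = no λ ()
  grid _ ≟-node t      = no λ ()
  s      ≟-node grid _ = no λ ()
  s      ≟-node s      = yes refl
  s      ≟-node t      = no λ ()
  t      ≟-node grid _ = no λ ()
  t      ≟-node s      = no λ ()
  t      ≟-node t      = yes refl

  private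
    lower : ∀ {m n} {i : Fin m} {j : Fin n} →
            toℕ j ≤ toℕ i → toℕ j ≤ toℕ (inject₁ i)
    lower {i = i} j≤i = ℕ.≤-trans j≤i (ℕ.≤-reflexive (sym (Fin.toℕ-inject₁ i)))

    lower₂ : ∀ {m n} {i : Fin m} {j : Fin n} →
             toℕ j ≤ toℕ i → toℕ (inject₁ j) ≤ toℕ (inject₁ i)
    lower₂ {i = i} {j} j≤i =
      ℕ.≤-trans (ℕ.≤-reflexive (Fin.toℕ-inject₁ j)) (lower {i = i} {j} j≤i)

    last : q ≤ p → (j : Fin (suc q)) → toℕ j ≤ toℕ (fromℕ p)
    last q≤p j = ℕ.≤-trans (ℕ.≤-trans (Fin.toℕ≤pred[n] j) q≤p)
                           (ℕ.≤-reflexive (sym (Fin.toℕ-fromℕ p)))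

  arcTail : .(q ≤ p) → Arc p q → Node p q
  arcTail q≤p (down ⟨ i , j ⟩[ h ]) =
    grid ⟨ inject₁ i , j ⟩[ lower {i = i} {j} h ]
  arcTail q≤p (diag ⟨ i , j ⟩[ h ]) =
    grid ⟨ inject₁ i , inject₁ j ⟩[ lower₂ {i = i} {j} h ]
  arcTail q≤p start                 = s
  arcTail q≤p (end j)               = grid ⟨ fromℕ p , j ⟩[ last q≤p j ]

  arcHead : Arc p q → Node p q
  arcHead (down ⟨ i , j ⟩[ h ]) = grid ⟨ Fin.suc i , j ⟩[ ℕ.m≤n⇒m≤1+n h ]
  arcHead (diag ⟨ i , j ⟩[ h ]) = grid ⟨ Fin.suc i , Fin.suc j ⟩[ s≤s h ]
  arcHead start                 = grid ⟨ Fin.zero , Fin.zero ⟩[ ℕ.≤-refl ]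
  arcHead (end _)               = t

  IsDiagonal : Pred (Arc p q) 0ℓ
  IsDiagonal (diag _) = ⊤
  IsDiagonal _        = ⊥

  isDiagonal? : Decidable IsDiagonal
  isDiagonal? (down _) = no λ ()
  isDiagonal? (diag _) = yes tt
  isDiagonal? start    = no λ ()
  isDiagonal? (end _)  = no λ ()

  in↘ : ∀ {ℓ} → .(q ≤ p) → Pred (Node p q) ℓ → Pred (Arc p q) ℓ
  in↘ q≤p W a = IsDiagonal a × W (arcHead a) × ¬ W (arcTail q≤p a)

  in↘? : ∀ {ℓ} .(q≤p : q ≤ p) {W : Pred (Node p q) ℓ} →
         Decidable W → Decidable (in↘ q≤p W)
  in↘? q≤p W? a =
    isDiagonal? a ×-dec (W? (arcHead a) ×-dec ¬? (W? (arcTail q≤p a)))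

  -- The index e is 0-based while the nodes are not, whence the suc's.

  colNodes : ℐ p q → Pred (Node p q) 0ℓ
  colNodes e (grid v) = toℕ (col v) ≡ suc (toℕ (col e))
                      × suc (toℕ (col e)) ≤ toℕ (row v)
                      × toℕ (row v) ≤ suc (toℕ (row e))
  colNodes e s        = ⊥
  colNodes e t        = ⊥

  colNodes? : ∀ e → Decidable (colNodes e)
  colNodes? e (grid v) = (toℕ (col v) ℕ.≟ suc (toℕ (col e)))
                   ×-dec (suc (toℕ (col e)) ℕ.≤? toℕ (row v))
                   ×-dec (toℕ (row v) ℕ.≤? suc (toℕ (row e)))
  colNodes? e s        = no λ ()
  colNodes? e t        = no λ ()

arc-finite : ∀ p q → Finite (Arc p q)
arc-finite p q = record
  { elements = start ∷ downs ++ diags ++ ends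
  ; complete = complete
  ; unique   = All.tabulate start∉
             ∷ Unique.++⁺ (Unique.map⁺ (λ { refl → refl }) (Finite.unique D))
                 (Unique.++⁺ (Unique.map⁺ (λ { refl → refl }) (Finite.unique G))
                             (Unique.map⁺ (λ { refl → refl }) (Unique.allFin⁺ _))
                             diags#ends)
                 downs#rest
  }
  where
  D : Finite (Staircase p (suc q))
  D = staircase-finite p (suc q)

  G : Finite (Staircase p q)
  G = staircase-finite p q

  downs diags ends : List (Arc p q)
  downs = map down (Finite.elements D)
  diags = map diag (Finite.elements G)
  ends  = map end (allFin (suc q))

  complete : ∀ a → a ∈ start ∷ downs ++ diags ++ ends
  complete (down u) = there (∈.∈-++⁺ˡ (∈.∈-map⁺ down (Finite.complete D u)))
  complete (diag u) = there (∈.∈-++⁺ʳ downs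
                        (∈.∈-++⁺ˡ (∈.∈-map⁺ diag (Finite.complete G u))))
  complete start    = here refl
  complete (end j)  = there (∈.∈-++⁺ʳ downs
                        (∈.∈-++⁺ʳ diags (∈.∈-map⁺ end (∈.∈-allFin j))))

  diags#ends : ∀ {a} → ¬ (a ∈ diags × a ∈ ends)
  diags#ends (a∈ , a∈′) with ∈.∈-map⁻ diag a∈ | ∈.∈-map⁻ end a∈′
  ... | _ , _ , refl | _ , _ , ()

  downs#rest : ∀ {a} → ¬ (a ∈ downs × a ∈ diags ++ ends)
  downs#rest (a∈ , a∈′) with ∈.∈-map⁻ down a∈ | ∈.∈-++⁻ diags a∈′
  ... | _ , _ , refl | inj₁ b∈ with () ← proj₂ (proj₂ (∈.∈-map⁻ diag b∈))
  ... | _ , _ , refl | inj₂ b∈ with () ← proj₂ (proj₂ (∈.∈-map⁻ end b∈))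

  start∉ : ∀ {a} → a ∈ downs ++ diags ++ ends → start ≢ a
  start∉ a∈ refl with ∈.∈-++⁻ downs a∈
  ... | inj₁ b∈ with () ← proj₂ (proj₂ (∈.∈-map⁻ down b∈))
  ... | inj₂ b∈ with ∈.∈-++⁻ diags b∈
  ...   | inj₁ c∈ with () ← proj₂ (proj₂ (∈.∈-map⁻ diag c∈))
  ...   | inj₂ c∈ with () ← proj₂ (proj₂ (∈.∈-map⁻ end c∈))

projection : ∀ {a b ℓ} {A : Set a} {B : Set b} →
             Pred (A × B) ℓ → Pred A (b ⊔ ℓ)
projection P x = ∃ λ y → P (x , y)

module Polyhedra {c ℓ₁ ℓ₂} (K : OrderedField c ℓ₁ ℓ₂) where

  open OrderedField K
  open import Algebra.Properties.CommutativeMonoid.Sum +-commutativeMonoid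
    using (sum)

  Point : Set → Set c
  Point E = E → Carrier

  sumOver : ∀ {E ℓ} → Finite E → {N : Pred E ℓ} → Decidable N →
            Point E → Carrier
  sumOver fin N? z = foldr (λ e r → z e + r) 0# (filter N? (Finite.elements fin))

  convexHull : ∀ {E ℓ} → Pred (Point E) ℓ → Pred (Point E) (c ⊔ ℓ₁ ⊔ ℓ₂ ⊔ ℓ)
  convexHull {E} S x =
    Σ ℕ λ n → Σ (Fin n → Carrier) λ μ → Σ (Fin n → Point E) λ z →
      (∀ k → 0# ≼ μ k)
    × sum μ ≈ 1#
    × (∀ k → S (z k))
    × (∀ e → x e ≈ sum (λ k → μ k * z k e))

  module _ (p q : ℕ) where

    entries : 01-Matrix p q → Point (ℐ p q)
    entries M e = if M (row e) (col e) then 1# else 0#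

    OrbitopeMatrix : Pred (Point (ℐ p q)) ℓ₁
    OrbitopeMatrix x = Σ (01-Matrix p q) λ M →
      LexDecreasingColumns M × AtMostOneOnePerRow M × (∀ e → x e ≈ entries M e)

    packingOrbitope : Pred (Point (ℐ p q)) (c ⊔ ℓ₁ ⊔ ℓ₂)
    packingOrbitope = convexHull OrbitopeMatrix

    module _ .(q≤p : q ≤ p) where

      inflow outflow : Point (Arc p q) → Node p q → Carrier
      inflow  y v =
        sumOver (arc-finite p q) (λ a → arcHead a ≟-node v) y
      outflow y v =
        sumOver (arc-finite p q) (λ a → arcTail q≤p a ≟-node v) y

      UnitFlow : Pred (Point (Arc p q)) (ℓ₁ ⊔ ℓ₂)
      UnitFlow y =
          (∀ a → 0# ≼ y a)
        × (∀ v → v ≢ s → v ≢ t → inflow y v ≈ outflow y v)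
        × outflow y s ≈ 1#

      -- By the 0-based indexing of ℐ, the diagonal arc with tail (i-1 , j-1)
      -- is diag e for the e that represents (i , j).

      extendedPolytope : Pred (Point (ℐ p q) × Point (Arc p q)) (ℓ₁ ⊔ ℓ₂)
      extendedPolytope (x , y) =
          UnitFlow y
        × (∀ e → y (diag e) ≼ x e)
        × (∀ e → sumOver (staircase-finite p q) (bar? e) x
               ≼ sumOver (arc-finite p q) (in↘? q≤p (colNodes? e)) y)

{-# OPTIONS --safe #-}
-- A 0/1-matrix with at most one 1 per row has lexicographically decreasing
-- columns iff a 1 in column j + 1 is always preceded by a 1 in a higher row of
-- column j.  It thus traces the path that steps diagonally exactly in the rows
-- where a new column gets its first 1, and the indicator of this path satisfies
-- (a) and (b).  By linearity the orbitope lies in the projection.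
--
-- Conversely, think of y as a random path.  By conservation the right-hand
-- side of (b) is the flow that arrives in row i in a column ≥ j, so after
-- subtracting y on the diagonal arcs (possible by (a)), the inequalities (b) say
-- that the rest of row i of x can be distributed over the vertical arcs in such a
-- way that an arc in column k only receives entries of columns ≤ k: the
-- admissible sets are nested, so tail inequalities suffice.  Going down row by
-- row, each measure on the path prefixes that end in a given node is split
-- according to this distribution, greedily rather than proportionally, so that
-- no division occurs.

module Submission where

open import Defs
open import Data.Nat.Base using (ℕ; _≤_)
open import Relation.Unary using (_≐_)
open import Algebra.Bundles using (CommutativeRing)
open import Data.Bool.Base as Bool using (Bool; true; false; if_then_else_; _∧_; not)
import Data.Bool.Properties as Bool
open import Data.Empty using (⊥; ⊥-elim)
open import Data.Fin.Base as Fin using (Fin; zero; suc; toℕ; fromℕ<; inject₁)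
import Data.Fin.Properties as Fin
open import Data.List.Base using (List; []; _∷_; _++_; map; filter; foldr; allFin)
open import Data.List.Membership.Propositional using (_∈_)
import Data.List.Membership.Propositional.Properties as ∈
open import Data.List.Membership.Propositional.Properties.WithK using (unique∧set⇒bag)
open import Data.List.Properties using (filter-++; filter-none; filter-≐)
open import Data.List.Relation.Binary.BagAndSetEquality using (∼bag⇒↭)
open import Data.List.Relation.Binary.Permutation.Propositional as ↭ using (_↭_)
open import Data.List.Relation.Unary.All as All using (All)
open import Data.List.Relation.Unary.AllPairs using (_∷_)
open import Data.List.Relation.Unary.Any using (here; there)
import Data.List.Relation.Unary.Unique.Propositional.Properties as Unique
open import Data.Maybe.Base using (Maybe; just; nothing)
open import Data.Maybe.Properties using (just-injective)
open import Data.Nat.Base as ℕ using (zero; suc; s≤s)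
open import Data.Nat.Induction using (<-rec)
import Data.Nat.Properties as ℕ
open import Data.Product.Base using (Σ; ∃; _×_; _,_; proj₁; proj₂)
open import Data.Sum.Base using (_⊎_; inj₁; inj₂)
open import Data.Unit.Base using (tt)
open import Data.Vec.Base as Vec using (Vec)
open import Data.Vec.Functional using () renaming (_∷_ to _◂_)
open import Data.Vec.Relation.Binary.Lex.NonStrict using (Lex-≤; base; this; next)
open import Function.Base using (_∘_)
open import Function.Bundles using (mk⇔)
open import Level using (0ℓ; _⊔_)
open import Relation.Binary.Bundles using (Poset)
open import Relation.Binary.Definitions using (tri<; tri≈; tri>)
open import Relation.Binary.PropositionalEquality as ≡ using (_≡_; _≢_)
open import Relation.Binary.Structures using (IsDecTotalOrder)
open import Relation.Nullary using (¬_; Dec; yes; no; does)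
open import Relation.Nullary.Decidable using (_×-dec_; recompute; dec-true; dec-false)
open import Relation.Unary using (Pred; Decidable)

-- A measure on prefixes enters the argument only through its total mass and the weighted sum of its
-- entry tables. This suffices because extending prefixes by the same arc and the same entry adds
-- one fixed matrix unit times their mass, so it is immaterial which of them receive the entry: a
-- split only has to hit prescribed masses. Whether an entry may be placed depends on the end node
-- alone, too: a prefix in node column k has already put a 1 into each of the k entry columns to its
-- left, so any of these may be used again without violating the lexicographic order. Masses are
-- never normalised, and nodes that carry no flow need no separate treatment. All quantities are
-- tables on pairs of natural numbers, extended by zero; conservation and (b) then hold, or are
-- trivial, outside the grid as well, and sums may be shifted freely.

-- Ordered-field arithmetic, finite sums and a transportation problem

module OrderedFieldProperties {c ℓ₁ ℓ₂} (K : OrderedField c ℓ₁ ℓ₂) where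

  open OrderedField K public using (_≼_; +-monoˡ-≼; *-nonNegative; isDecTotalOrder)
  open CommutativeRing (OrderedField.commutativeRing K) public
    using ( Carrier; _≈_; _+_; _*_; -_; 0#; 1#; refl; sym; trans; reflexive; setoid
          ; +-cong; +-congˡ; +-congʳ; +-assoc; +-comm; +-identityˡ; +-identityʳ
          ; -‿inverseˡ; -‿inverseʳ; *-congˡ; *-congʳ; *-identityʳ
          ; zeroˡ; zeroʳ; distribˡ; distribʳ; semiring; ring; +-group; +-commutativeMonoid)
  open IsDecTotalOrder isDecTotalOrder public using ()
    renaming ( reflexive to ≼-reflexive; refl to ≼-refl; trans to ≼-trans
             ; antisym to ≼-antisym; total to ≼-total
             ; ≤-respˡ-≈ to ≼-respˡ-≈; ≤-respʳ-≈ to ≼-respʳ-≈ )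
  open import Algebra.Properties.Semiring.Sum semiring public
    using (sum; sum-cong-≋; sum-replicate-zero; ∑-distrib-+; ∑-comm; *-distribʳ-sum)
  open import Algebra.Properties.Group +-group public using ()
    renaming (∙-cancelˡ to +-cancelˡ)
  open import Algebra.Properties.Ring ring using (-1*x≈-x; -‿involutive)
  open import Algebra.Solver.CommutativeMonoid +-commutativeMonoid public
    using (solve; _⊕_; _⊜_; id)

  ≼-poset : Poset _ _ _
  ≼-poset = record { isPartialOrder = IsDecTotalOrder.isPartialOrder isDecTotalOrder }

  module ≈-Reasoning where
    open import Relation.Binary.Reasoning.Setoid setoid public hiding (start)
  module ≼-Reasoning where
    open import Relation.Binary.Reasoning.PartialOrder ≼-poset public hiding (start)

  +-mono-≼ : ∀ {a b c d} → a ≼ b → c ≼ d → a + c ≼ b + d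
  +-mono-≼ {a} {b} {c} {d} a≼b c≼d = begin
    a + c  ≤⟨ +-monoˡ-≼ c a≼b ⟩
    b + c  ≈⟨ +-comm b c ⟩
    c + b  ≤⟨ +-monoˡ-≼ b c≼d ⟩
    d + b  ≈⟨ +-comm d b ⟩
    b + d  ∎
    where open ≼-Reasoning

  +-cancelʳ-≼ : ∀ c {a b} → a + c ≼ b + c → a ≼ b
  +-cancelʳ-≼ c {a} {b} h = begin
    a               ≈⟨ lemma a ⟨
    a + c + - c     ≤⟨ +-monoˡ-≼ (- c) h ⟩
    b + c + - c     ≈⟨ lemma b ⟩
    b               ∎
    where
    open ≼-Reasoning
    lemma : ∀ x → x + c + - c ≈ x
    lemma x = trans (+-assoc x c (- c)) (trans (+-congˡ (-‿inverseʳ c)) (+-identityʳ x))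

  +-nonNegative : ∀ {a b} → 0# ≼ a → 0# ≼ b → 0# ≼ a + b
  +-nonNegative 0≼a 0≼b = ≼-respˡ-≈ (+-identityˡ 0#) (+-mono-≼ 0≼a 0≼b)

  x≼x+y : ∀ x {y} → 0# ≼ y → x ≼ x + y
  x≼x+y x 0≼y = ≼-respˡ-≈ (+-identityʳ x) (+-mono-≼ (≼-refl {x}) 0≼y)

  -- Differences enter the main argument in this form: as a named nonnegative summand they keep
  -- later calculations inside the additive monoid, where the solver applies.
  ≼⇒∃+ : ∀ {a b} → a ≼ b → ∃ λ d → 0# ≼ d × a + d ≈ b
  ≼⇒∃+ {a} {b} a≼b = b + - a , 0≼d , eq
    where
    0≼d : 0# ≼ b + - a
    0≼d = ≼-respˡ-≈ (-‿inverseʳ a) (+-monoˡ-≼ (- a) a≼b)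
    eq : a + (b + - a) ≈ b
    eq = trans (+-comm a _) (trans (+-assoc b (- a) a) (trans (+-congˡ (-‿inverseˡ a)) (+-identityʳ b)))

  0≼1 : 0# ≼ 1#
  0≼1 with ≼-total 0# 1#
  ... | inj₁ h = h
  -- If 1 were at most 0, then -1 would be nonnegative, and so would its square, which is 1.
  ... | inj₂ 1≼0 = ≼-respʳ-≈ (trans (-1*x≈-x (- 1#)) (-‿involutive 1#)) (*-nonNegative 0≼-1 0≼-1)
    where
    0≼-1 : 0# ≼ - 1#
    0≼-1 = ≼-respʳ-≈ (+-identityˡ (- 1#)) (≼-respˡ-≈ (-‿inverseʳ 1#) (+-monoˡ-≼ (- 1#) 1≼0))

  *-monoˡ-≼ : ∀ {m a b} → 0# ≼ m → a ≼ b → m * a ≼ m * b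
  *-monoˡ-≼ {m} {a} {b} 0≼m a≼b with d , 0≼d , eq ← ≼⇒∃+ a≼b =
    ≼-respʳ-≈ (trans (sym (distribˡ m a d)) (*-congˡ eq)) (x≼x+y (m * a) (*-nonNegative 0≼m 0≼d))

  +≈0⇒≈0 : ∀ {a b} → 0# ≼ a → 0# ≼ b → a + b ≈ 0# → a ≈ 0#
  +≈0⇒≈0 {a} 0≼a 0≼b eq = ≼-antisym (≼-respʳ-≈ eq (x≼x+y a 0≼b)) 0≼a

  sum-mono-≼ : ∀ {n} {f g : Fin n → Carrier} → (∀ k → f k ≼ g k) → sum f ≼ sum g
  sum-mono-≼ {zero}  h = ≼-refl
  sum-mono-≼ {suc n} h = +-mono-≼ (h zero) (sum-mono-≼ (h ∘ suc))

  sum-zero : ∀ {n} {f : Fin n → Carrier} → (∀ k → f k ≈ 0#) → sum f ≈ 0#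
  sum-zero {n} h = trans (sum-cong-≋ h) (sum-replicate-zero n)

  sum-nonNegative : ∀ {n} {f : Fin n → Carrier} → (∀ k → 0# ≼ f k) → 0# ≼ sum f
  sum-nonNegative {n} h = ≼-respˡ-≈ (sum-replicate-zero n) (sum-mono-≼ h)

  -- Summands are functions on ℕ, so that ranges can be shifted to `j + l` without casts between
  -- `Fin` types.
  Σ< : ℕ → (ℕ → Carrier) → Carrier
  Σ< n f = sum {n} (λ k → f (toℕ k))

  Σ<-cong : ∀ n {f g : ℕ → Carrier} → (∀ k → k ℕ.< n → f k ≈ g k) → Σ< n f ≈ Σ< n g
  Σ<-cong n h = sum-cong-≋ {n} (λ k → h (toℕ k) (Fin.toℕ<n k))

  Σ<-zero : ∀ n {f : ℕ → Carrier} → (∀ k → k ℕ.< n → f k ≈ 0#) → Σ< n f ≈ 0#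
  Σ<-zero n h = sum-zero {n} (λ k → h (toℕ k) (Fin.toℕ<n k))

  Σ<-distrib-+ : ∀ n (f g : ℕ → Carrier) → Σ< n (λ k → f k + g k) ≈ Σ< n f + Σ< n g
  Σ<-distrib-+ n f g = ∑-distrib-+ {n} _ _

  Σ<-swap : ∀ m n (f : ℕ → ℕ → Carrier) →
            Σ< m (λ k → Σ< n (f k)) ≈ Σ< n (λ l → Σ< m (λ k → f k l))
  Σ<-swap m n f = ∑-comm {m} {n} (λ k l → f (toℕ k) (toℕ l))

  Σ<-*-distribʳ : ∀ n (f : ℕ → Carrier) a → Σ< n (λ k → f k * a) ≈ Σ< n f * a
  Σ<-*-distribʳ n f a = sym (*-distribʳ-sum {n} a _)

  -- Both sides are the sum over 0, ..., n. A sum unfolds at its front only; this moves the split to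
  -- the back, where the last term is zero in the applications.
  Σ<-shift : ∀ n (f : ℕ → Carrier) → f 0 + Σ< n (f ∘ suc) ≈ Σ< n f + f n
  Σ<-shift zero    f = +-comm _ _
  Σ<-shift (suc n) f = trans (+-congˡ (Σ<-shift n (f ∘ suc))) (sym (+-assoc _ _ _))

  -- Greedy filling: entry 0 takes as much as it can hold, and only the remaining amount is passed
  -- on.
  portion : ∀ n (r : ℕ → Carrier) {a} → (∀ k → 0# ≼ r k) → 0# ≼ a → a ≼ Σ< n r →
            ∃ λ z → (∀ k → 0# ≼ z k) × (∀ k → z k ≼ r k) × Σ< n z ≈ a
  portion zero r 0≼r 0≼a a≼0 = (λ _ → 0#) , (λ _ → ≼-refl) , 0≼r , ≼-antisym 0≼a a≼0
  portion (suc n) r {a} 0≼r 0≼a a≼r with ≼-total a (r 0)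
  ... | inj₁ a≼r₀ = (λ { zero → a ; (suc k) → 0# })
                  , (λ { zero → 0≼a ; (suc k) → ≼-refl })
                  , (λ { zero → a≼r₀ ; (suc k) → 0≼r (suc k) })
                  , trans (+-congˡ (sum-replicate-zero n)) (+-identityʳ a)
  ... | inj₂ r₀≼a with d , 0≼d , eq ← ≼⇒∃+ r₀≼a
      with z , 0≼z , z≼r , Σz ← portion n (r ∘ suc) (0≼r ∘ suc) 0≼d
             (+-cancelʳ-≼ (r 0) (≼-respˡ-≈ (trans (sym eq) (+-comm _ d)) (≼-respʳ-≈ (+-comm _ _) a≼r)))
      = (λ { zero → r 0 ; (suc k) → z k })
      , (λ { zero → 0≼r 0 ; (suc k) → 0≼z k })
      , (λ { zero → ≼-refl ; (suc k) → z≼r k })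
      , trans (+-congˡ Σz) eq

  -- Supplier k may serve the demands l ≤ k only.  Since the sets of admissible
  -- suppliers are nested, the tail inequalities are Hall's condition; the
  -- demand 0, which anybody may serve, is satisfied last.
  transport : ∀ n (a b : ℕ → Carrier) → (∀ l → 0# ≼ a l) → (∀ k → 0# ≼ b k) →
              (∀ j d → j ℕ.+ d ≡ n → Σ< d (λ l → a (j ℕ.+ l)) ≼ Σ< d (λ l → b (j ℕ.+ l))) →
              Σ (ℕ → ℕ → Carrier) λ z →
                (∀ k l → 0# ≼ z k l)
              × (∀ k l → k ℕ.< l → z k l ≈ 0#)
              × (∀ l → l ℕ.< n → Σ< n (λ k → z k l) ≈ a l)
              × (∀ k → Σ< n (z k) ≼ b k)
  transport zero a b 0≼a 0≼b tails =
    (λ _ _ → 0#) , (λ _ _ → ≼-refl) , (λ _ _ _ → refl) , (λ _ ()) , 0≼b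
  transport (suc n) a b 0≼a 0≼b tails
    with z , 0≼z , z-upper , z-col , z-row
           ← transport n (a ∘ suc) (b ∘ suc) (0≼a ∘ suc) (0≼b ∘ suc)
                       (λ j d eq → tails (suc j) d (≡.cong suc eq)) =
    z⁺ , 0≼z⁺ , z⁺-upper , z⁺-col , z⁺-row
    where
    residual : ∀ k → ∃ λ d → 0# ≼ d × Σ< n (z k) + d ≈ b (suc k)
    residual k = ≼⇒∃+ (z-row k)

    -- What each supplier has left once the demands above 0 are met; supplier 0 could serve none of
    -- those and still has all of `b 0`.
    r : ℕ → Carrier
    r zero    = b 0
    r (suc k) = proj₁ (residual k)

    0≼r : ∀ k → 0# ≼ r k
    0≼r zero    = 0≼b 0
    0≼r (suc k) = proj₁ (proj₂ (residual k))

    Σb : Σ< (suc n) r + Σ< n (a ∘ suc) ≈ Σ< (suc n) b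
    Σb = begin
      (b 0 + Σ< n (r ∘ suc)) + Σ< n (a ∘ suc)
        ≈⟨ +-congˡ (Σ<-cong n z-col) ⟨
      (b 0 + Σ< n (r ∘ suc)) + Σ< n (λ l → Σ< n (λ k → z k l))
        ≈⟨ +-congˡ (Σ<-swap n n (λ l k → z k l)) ⟩
      (b 0 + Σ< n (r ∘ suc)) + Σ< n (λ k → Σ< n (z k))
        ≈⟨ solve 3 (λ x y z → (x ⊕ y) ⊕ z ⊜ x ⊕ (z ⊕ y)) refl _ _ _ ⟩
      b 0 + (Σ< n (λ k → Σ< n (z k)) + Σ< n (r ∘ suc))
        ≈⟨ +-congˡ (Σ<-distrib-+ n (λ k → Σ< n (z k)) (r ∘ suc)) ⟨
      b 0 + Σ< n (λ k → Σ< n (z k) + r (suc k))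
        ≈⟨ +-congˡ (Σ<-cong n (λ k _ → proj₂ (proj₂ (residual k)))) ⟩
      b 0 + Σ< n (b ∘ suc) ∎
      where open ≈-Reasoning

    -- The tail inequality for j = 0 is consumed here: total supply minus the demands already served
    -- is the sum of `r`.
    a₀≼r : a 0 ≼ Σ< (suc n) r
    a₀≼r = +-cancelʳ-≼ (Σ< n (a ∘ suc)) (≼-respʳ-≈ (sym Σb) (tails 0 (suc n) ≡.refl))

    served : ∃ λ y → (∀ k → 0# ≼ y k) × (∀ k → y k ≼ r k) × Σ< (suc n) y ≈ a 0
    served = portion (suc n) r 0≼r (0≼a 0) a₀≼r

    z⁺ : ℕ → ℕ → Carrier
    z⁺ k       zero    = proj₁ served k
    z⁺ zero    (suc l) = 0#
    z⁺ (suc k) (suc l) = z k l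

    0≼z⁺ : ∀ k l → 0# ≼ z⁺ k l
    0≼z⁺ k       zero    = proj₁ (proj₂ served) k
    0≼z⁺ zero    (suc l) = ≼-refl
    0≼z⁺ (suc k) (suc l) = 0≼z k l

    z⁺-upper : ∀ k l → k ℕ.< l → z⁺ k l ≈ 0#
    z⁺-upper k       zero    ()
    z⁺-upper zero    (suc l) _         = refl
    z⁺-upper (suc k) (suc l) (ℕ.s≤s h) = z-upper k l h

    z⁺-col : ∀ l → l ℕ.< suc n → Σ< (suc n) (λ k → z⁺ k l) ≈ a l
    z⁺-col zero    _         = proj₂ (proj₂ (proj₂ served))
    z⁺-col (suc l) (ℕ.s≤s h) = trans (+-identityˡ _) (z-col l h)

    z⁺-row : ∀ k → Σ< (suc n) (z⁺ k) ≼ b k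
    z⁺-row zero = ≼-respˡ-≈ (sym (trans (+-congˡ (sum-replicate-zero n)) (+-identityʳ _)))
                            (proj₁ (proj₂ (proj₂ served)) 0)
    z⁺-row (suc k) = begin
      proj₁ served (suc k) + Σ< n (z k)  ≤⟨ +-monoˡ-≼ _ (proj₁ (proj₂ (proj₂ served)) (suc k)) ⟩
      r (suc k) + Σ< n (z k)             ≈⟨ +-comm _ _ ⟩
      Σ< n (z k) + r (suc k)             ≈⟨ proj₂ (proj₂ (residual k)) ⟩
      b (suc k)                          ∎
      where open ≼-Reasoning

-- Points on staircases as tables, and sums over finite index sets

At : ∀ {m n} → ℕ → ℕ → Pred (Staircase m n) 0ℓ
At i j u = toℕ (row u) ≡ i × toℕ (col u) ≡ j

inside : ∀ {m n i j} → i ℕ.< m → j ℕ.< n → j ℕ.≤ i → ∃ (At {m} {n} i j)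
inside i<m j<n j≤i =
  ⟨ fromℕ< i<m , fromℕ< j<n ⟩[ ≡.subst₂ ℕ._≤_ (≡.sym (Fin.toℕ-fromℕ< j<n)) (≡.sym (Fin.toℕ-fromℕ< i<m)) j≤i ]
  , Fin.toℕ-fromℕ< i<m , Fin.toℕ-fromℕ< j<n

-- The stored inequality is irrelevant and cannot be projected out; being decidable, it can be
-- recomputed.
col≤row′ : ∀ {m n} (u : Staircase m n) → toℕ (col u) ℕ.≤ toℕ (row u)
col≤row′ ⟨ i , j ⟩[ h ] = recompute (toℕ j ℕ.≤? toℕ i) h

at? : ∀ m n i j → Dec (∃ (At {m} {n} i j))
at? m n i j with i ℕ.<? m | j ℕ.<? n | j ℕ.≤? i
... | no ¬i<m | _       | _       = no λ { (u , ≡.refl , _) → ¬i<m (Fin.toℕ<n (row u)) }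
... | yes _   | no ¬j<n | _       = no λ { (u , _ , ≡.refl) → ¬j<n (Fin.toℕ<n (col u)) }
... | yes _   | yes _   | no ¬j≤i = no λ { (u , ≡.refl , ≡.refl) → ¬j≤i (col≤row′ u) }
... | yes i<m | yes j<n | yes j≤i = yes (inside i<m j<n j≤i)

At-unique : ∀ {m n i j} {u v : Staircase m n} → At i j u → At i j v → u ≡ v
At-unique (ru , cu) (rv , cv) = staircase-≡ (Fin.toℕ-injective (≡.trans ru (≡.sym rv)))
                                            (Fin.toℕ-injective (≡.trans cu (≡.sym cv)))

fin-finite : ∀ n → Finite (Fin n)
fin-finite n = record { elements = allFin n ; complete = ∈.∈-allFin ; unique = Unique.allFin⁺ n }

module FiniteSums {c ℓ₁ ℓ₂} (K : OrderedField c ℓ₁ ℓ₂) where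
  open OrderedFieldProperties K
  open Polyhedra K

  sumList : ∀ {E : Set} → List E → Point E → Carrier
  sumList xs z = foldr (λ e r → z e + r) 0# xs

  sumList-++ : ∀ {E : Set} (xs ys : List E) (z : Point E) →
               sumList (xs ++ ys) z ≈ sumList xs z + sumList ys z
  sumList-++ []       ys z = sym (+-identityˡ _)
  sumList-++ (x ∷ xs) ys z = trans (+-congˡ (sumList-++ xs ys z)) (sym (+-assoc _ _ _))

  sumList-↭ : ∀ {E : Set} {xs ys : List E} (z : Point E) → xs ↭ ys → sumList xs z ≈ sumList ys z
  sumList-↭ z ↭.refl = refl
  sumList-↭ z (↭.prep x h) = +-congˡ (sumList-↭ z h)
  sumList-↭ z (↭.swap x y h) =
    trans (+-congˡ (+-congˡ (sumList-↭ z h))) (solve 3 (λ a b c → a ⊕ (b ⊕ c) ⊜ b ⊕ (a ⊕ c)) refl _ _ _)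
  sumList-↭ z (↭.trans h h′) = trans (sumList-↭ z h) (sumList-↭ z h′)

  sumList-filter-map : ∀ {E F : Set} {ℓ} {N : Pred F ℓ} (N? : Decidable N) (f : E → F) xs (z : Point F) →
                       sumList (filter N? (map f xs)) z ≈ sumList (filter (N? ∘ f) xs) (z ∘ f)
  sumList-filter-map N? f []       z = refl
  sumList-filter-map N? f (x ∷ xs) z with does (N? (f x))
  ... | true  = +-congˡ (sumList-filter-map N? f xs z)
  ... | false = sumList-filter-map N? f xs z

  -- Conservation and (b) are made of such sums, so this carries them from single matrices to convex
  -- combinations.
  sumList-linear : ∀ {E : Set} {n} xs (μ : Fin n → Carrier) (z : Fin n → Point E) →
                   sumList xs (λ e → sum (λ k → μ k * z k e)) ≈ sum (λ k → μ k * sumList xs (z k))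
  sumList-linear []       μ z = sym (sum-zero (λ k → zeroʳ (μ k)))
  sumList-linear (x ∷ xs) μ z = begin
    sum (λ k → μ k * z k x) + sumList xs (λ e → sum (λ k → μ k * z k e))
      ≈⟨ +-congˡ (sumList-linear xs μ z) ⟩
    sum (λ k → μ k * z k x) + sum (λ k → μ k * sumList xs (z k))
      ≈⟨ ∑-distrib-+ (λ k → μ k * z k x) (λ k → μ k * sumList xs (z k)) ⟨
    sum (λ k → μ k * z k x + μ k * sumList xs (z k))
      ≈⟨ sum-cong-≋ (λ k → sym (distribˡ (μ k) (z k x) (sumList xs (z k)))) ⟩
    sum (λ k → μ k * (z k x + sumList xs (z k)))  ∎
    where open ≈-Reasoning

  sumList-cong : ∀ {E : Set} xs {y z : Point E} → (∀ e → y e ≈ z e) → sumList xs y ≈ sumList xs z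
  sumList-cong []       h = refl
  sumList-cong (x ∷ xs) h = +-cong (h x) (sumList-cong xs h)

  module _ {E : Set} (fin : Finite E) where
    open Finite fin

    module _ {ℓ} {N : Pred E ℓ} (N? : Decidable N) where

      sumOver-∅ : (∀ e → ¬ N e) → ∀ z → sumOver fin N? z ≈ 0#
      sumOver-∅ ∉N z = reflexive (≡.cong (λ xs → sumList xs z) (filter-none N? (All.universal ∉N elements)))

      module _ {ℓ′} {N′ : Pred E ℓ′} (N′? : Decidable N′) where

        sumOver-≐ : N ≐ N′ → ∀ z → sumOver fin N? z ≈ sumOver fin N′? z
        sumOver-≐ N≐N′ z = reflexive (≡.cong (λ xs → sumList xs z) (filter-≐ N? N′? N≐N′ elements))

        -- The filtered lists may differ in order, but both sides list the same members without
        -- duplicates, hence are permutations of each other.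
        sumOver-insert : ∀ e → N e → ¬ N′ e → (∀ {f} → N f → f ≡ e ⊎ N′ f) → (∀ {f} → N′ f → N f) →
                         ∀ z → sumOver fin N? z ≈ z e + sumOver fin N′? z
        sumOver-insert e e∈N e∉N′ N⊆ N′⊆N z =
          sumList-↭ z (∼bag⇒↭ (unique∧set⇒bag (Unique.filter⁺ N? unique)
            (All.tabulate (λ f∈ → λ { ≡.refl → e∉N′ (proj₂ (∈.∈-filter⁻ N′? {xs = elements} f∈)) })
              ∷ Unique.filter⁺ N′? unique)
            (mk⇔ to from)))
          where
          to : ∀ {f} → f ∈ filter N? elements → f ∈ e ∷ filter N′? elements
          to {f} f∈ with N⊆ (proj₂ (∈.∈-filter⁻ N? {xs = elements} f∈))
          ... | inj₁ f≡e = here f≡e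
          ... | inj₂ f∈N′ = there (∈.∈-filter⁺ N′? (complete f) f∈N′)
          from : ∀ {f} → f ∈ e ∷ filter N′? elements → f ∈ filter N? elements
          from (here ≡.refl) = ∈.∈-filter⁺ N? (complete e) e∈N
          from {f} (there f∈) = ∈.∈-filter⁺ N? (complete f) (N′⊆N (proj₂ (∈.∈-filter⁻ N′? {xs = elements} f∈)))

      sumOver-linear : ∀ {n} (μ : Fin n → Carrier) (z : Fin n → Point E) →
                       sumOver fin N? (λ e → sum (λ k → μ k * z k e)) ≈ sum (λ k → μ k * sumOver fin N? (z k))
      sumOver-linear = sumList-linear (filter N? elements)

      sumOver-cong : ∀ {y z : Point E} → (∀ e → y e ≈ z e) → sumOver fin N? y ≈ sumOver fin N? z
      sumOver-cong = sumList-cong (filter N? elements)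

    sumOver-single : ∀ {ℓ} {N : Pred E ℓ} (N? : Decidable N) e → N e → (∀ {f} → N f → f ≡ e) →
                     ∀ z → sumOver fin N? z ≈ z e
    sumOver-single N? e e∈N only z =
      trans (sumOver-insert N? (λ _ → no (λ (b : ⊥) → b)) e e∈N (λ b → b) (inj₁ ∘ only) ⊥-elim z)
            (trans (+-congˡ (sumOver-∅ _ (λ _ b → b) z)) (+-identityʳ _))

  -- Missing arcs and entries above the diagonal count as 0, which spares the recursions over rows
  -- and columns their boundary cases.
  ext : ∀ {m n} → Point (Staircase m n) → ℕ → ℕ → Carrier
  ext {m} {n} z i j with at? m n i j
  ... | yes (u , _) = z u
  ... | no  _       = 0#

  module _ {m n : ℕ} (z : Point (Staircase m n)) where

    ext-inside : ∀ {i j} u → At i j u → ext z i j ≡ z u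
    ext-inside {i} {j} u u∈ with at? m n i j
    ... | yes (v , v∈) = ≡.cong z (At-unique v∈ u∈)
    ... | no  ∄        = ⊥-elim (∄ (u , u∈))

    ext-outside : ∀ {i j} → (∀ u → ¬ At i j u) → ext z i j ≡ 0#
    ext-outside {i} {j} ∄ with at? m n i j
    ... | yes (v , v∈) = ⊥-elim (∄ v v∈)
    ... | no  _        = ≡.refl

    ext-at : ∀ u → ext z (toℕ (row u)) (toℕ (col u)) ≡ z u
    ext-at u = ext-inside u (≡.refl , ≡.refl)

    ext-elim : ∀ {ℓ} (P : Pred Carrier ℓ) → P 0# → (∀ u → P (z u)) → ∀ i j → P (ext z i j)
    ext-elim P P0 Pz i j with at? m n i j
    ... | yes (v , _) = Pz v
    ... | no  _       = P0

    ext-col> : ∀ {i j} → i ℕ.< j → ext z i j ≡ 0#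
    ext-col> i<j = ext-outside λ { u (≡.refl , ≡.refl) → ℕ.<⇒≱ i<j (col≤row′ u) }

    ext-col≥ : ∀ {i j} → n ℕ.≤ j → ext z i j ≡ 0#
    ext-col≥ n≤j = ext-outside λ { u (_ , ≡.refl) → ℕ.<⇒≱ (Fin.toℕ<n (col u)) n≤j }

    ext-table : (F : ℕ → ℕ → Carrier) → (∀ u → z u ≈ F (toℕ (row u)) (toℕ (col u))) →
                (∀ {i j} → i ℕ.< j → F i j ≈ 0#) → (∀ {i j} → n ℕ.≤ j → F i j ≈ 0#) →
                ∀ {i} → i ℕ.< m → ∀ j → ext z i j ≈ F i j
    ext-table F z≈F upper right {i} i<m j with i ℕ.<? j | n ℕ.≤? j
    ... | yes i<j | _       = trans (reflexive (ext-col> i<j)) (sym (upper i<j))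
    ... | no _    | yes n≤j = trans (reflexive (ext-col≥ n≤j)) (sym (right n≤j))
    ... | no i≮j  | no n≰j  with u , ≡.refl , ≡.refl ← inside {m} {n} i<m (ℕ.≰⇒> n≰j) (ℕ.≮⇒≥ i≮j)
                            = trans (reflexive (ext-at u)) (z≈F u)

    sumOver-At : ∀ {ℓ} {N : Pred (Staircase m n) ℓ} (N? : Decidable N) i j → N ≐ At i j →
                 sumOver (staircase-finite m n) N? z ≈ ext z i j
    sumOver-At N? i j (N⊆ , ⊆N) with at? m n i j
    ... | yes (u , u∈) = sumOver-single (staircase-finite m n) N? u (⊆N u∈) (λ f∈ → At-unique (N⊆ f∈) u∈) z
    ... | no  ∄        = sumOver-∅ (staircase-finite m n) N? (λ f f∈ → ∄ (f , N⊆ f∈)) z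

  ext-mono : ∀ {m n} {z z′ : Point (Staircase m n)} → (∀ u → z u ≼ z′ u) → ∀ i j → ext z i j ≼ ext z′ i j
  ext-mono {m} {n} z≼z′ i j with at? m n i j
  ... | yes (u , _) = z≼z′ u
  ... | no  _       = ≼-refl

  sumOver-arc : ∀ {p q ℓ} {N : Pred (Arc p q) ℓ} (N? : Decidable N) (y : Point (Arc p q)) →
                sumOver (arc-finite p q) N? y ≈
                  (if does (N? start) then y start else 0#)
                + (sumOver (staircase-finite p (suc q)) (N? ∘ down) (y ∘ down)
                + (sumOver (staircase-finite p q) (N? ∘ diag) (y ∘ diag)
                + sumOver (fin-finite (suc q)) (N? ∘ end) (y ∘ end)))
  sumOver-arc {p} {q} N? y = trans split-start (+-congˡ (begin
    sumList (filter N? (ds ++ gs ++ es)) y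
      ≈⟨ split-++ ds (gs ++ es) ⟩
    sumList (filter N? ds) y + sumList (filter N? (gs ++ es)) y
      ≈⟨ +-congˡ (split-++ gs es) ⟩
    sumList (filter N? ds) y + (sumList (filter N? gs) y + sumList (filter N? es) y)
      ≈⟨ +-cong (sumList-filter-map N? down (Finite.elements (staircase-finite p (suc q))) y)
        (+-cong (sumList-filter-map N? diag (Finite.elements (staircase-finite p q)) y)
                (sumList-filter-map N? end (allFin (suc q)) y)) ⟩
    _ ∎))
    where
    open ≈-Reasoning
    ds gs es : List (Arc p q)
    ds = map down (Finite.elements (staircase-finite p (suc q)))
    gs = map diag (Finite.elements (staircase-finite p q))
    es = map end (allFin (suc q))
    split-++ : ∀ xs ys → sumList (filter N? (xs ++ ys)) y ≈ sumList (filter N? xs) y + sumList (filter N? ys) y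
    split-++ xs ys = trans (reflexive (≡.cong (λ l → sumList l y) (filter-++ N? xs ys)))
                           (sumList-++ (filter N? xs) (filter N? ys) y)
    split-start : sumOver (arc-finite p q) N? y ≈
                  (if does (N? start) then y start else 0#) + sumList (filter N? (ds ++ gs ++ es)) y
    split-start with does (N? start)
    ... | true  = refl
    ... | false = sym (+-identityˡ _)

-- Flow quantities of the digraph in coordinates

-- `bar` and `colNodes` are anchored at an element of the staircase; this predicate and `colBelow`
-- take arbitrary numbers, so that inductions can run past its boundary.
rowFrom : ∀ {m n} → ℕ → ℕ → Pred (Staircase m n) 0ℓ
rowFrom i j u = toℕ (row u) ≡ i × j ℕ.≤ toℕ (col u)

rowFrom? : ∀ {m n} i j → Decidable (rowFrom {m} {n} i j)
rowFrom? i j u = (toℕ (row u) ℕ.≟ i) ×-dec (j ℕ.≤? toℕ (col u))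

colBelow : ∀ {m n} → ℕ → ℕ → Pred (Staircase m n) 0ℓ
colBelow i j u = toℕ (row u) ℕ.< i × toℕ (col u) ≡ j

colBelow? : ∀ {m n} i j → Decidable (colBelow {m} {n} i j)
colBelow? i j u = (toℕ (row u) ℕ.<? i) ×-dec (toℕ (col u) ℕ.≟ j)

module FlowSums {c ℓ₁ ℓ₂} (K : OrderedField c ℓ₁ ℓ₂) where
  open OrderedFieldProperties K
  open Polyhedra K
  open FiniteSums K

  -- With `g i j` the flow on the diagonal arc with tail (i , j), this is the flow that has crossed
  -- from node column j to j + 1 by row i, the right-hand side of (b).
  colSum : (ℕ → ℕ → Carrier) → ℕ → ℕ → Carrier
  colSum g zero    j = 0#
  colSum g (suc i) j = colSum g i j + g i j

  -- The flow that enters the node (i , j), if σ enters (0 , 0).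
  nodeFlow : Carrier → (d g : ℕ → ℕ → Carrier) → ℕ → ℕ → Carrier
  nodeFlow σ d g zero    zero    = σ
  nodeFlow σ d g zero    (suc j) = 0#
  nodeFlow σ d g (suc i) zero    = d i 0
  nodeFlow σ d g (suc i) (suc j) = d i (suc j) + g i j

  module _ {m n : ℕ} (z : Point (Staircase m n)) where

    sumOver-colBelow : ∀ i j → sumOver (staircase-finite m n) (colBelow? i j) z ≈ colSum (ext z) i j
    sumOver-colBelow zero    j = sumOver-∅ (staircase-finite m n) (colBelow? 0 j) (λ { _ (() , _) }) z
    sumOver-colBelow (suc i) j with at? m n i j
    ... | yes (u , u∈@(r , c)) =
      trans (sumOver-insert (staircase-finite m n) (colBelow? (suc i) j) (colBelow? i j) u
               (ℕ.≤-reflexive (≡.cong suc r) , c) (λ { (lt , _) → ℕ.<⇒≢ lt r }) from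
               (λ {f} → λ { (lt , c) → ℕ.m<n⇒m<1+n lt , c }) z)
            (trans (+-comm _ _) (+-congʳ (sumOver-colBelow i j)))
      where
      from : ∀ {f} → colBelow (suc i) j f → f ≡ u ⊎ colBelow i j f
      from {f} (lt , c) with ℕ.m≤n⇒m<n∨m≡n (ℕ.≤-pred lt)
      ... | inj₁ lt′ = inj₂ (lt′ , c)
      ... | inj₂ eq  = inj₁ (At-unique (eq , c) u∈)
    ... | no ∄ =
      trans (sumOver-≐ (staircase-finite m n) (colBelow? (suc i) j) (colBelow? i j)
               ((λ {f} → from {f}) , λ { (lt , c) → ℕ.m<n⇒m<1+n lt , c }) z)
            (trans (sumOver-colBelow i j) (sym (+-identityʳ _)))
      where
      from : ∀ {f} → colBelow (suc i) j f → colBelow i j f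
      from {f} (lt , c) with ℕ.m≤n⇒m<n∨m≡n (ℕ.≤-pred lt)
      ... | inj₁ lt′ = lt′ , c
      ... | inj₂ eq  = ⊥-elim (∄ (f , eq , c))

    sumOver-rowFrom : ∀ i j d → j ℕ.+ d ≡ n →
                      sumOver (staircase-finite m n) (rowFrom? i j) z ≈ Σ< d (λ l → ext z i (j ℕ.+ l))
    sumOver-rowFrom i j zero eq =
      sumOver-∅ (staircase-finite m n) (rowFrom? i j)
        (λ u (_ , j≤) → ℕ.<⇒≱ (Fin.toℕ<n (col u)) (ℕ.≤-trans (ℕ.≤-reflexive (≡.trans (≡.sym eq) (ℕ.+-identityʳ j))) j≤)) z
    sumOver-rowFrom i j (suc d) eq = trans peel (+-congˡ (trans
        (sumOver-rowFrom i (suc j) d (≡.trans (≡.sym (ℕ.+-suc j d)) eq))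
        (Σ<-cong d (λ l _ → reflexive (≡.cong (ext z i) (≡.sym (ℕ.+-suc j l)))))))
      where
      peel : sumOver (staircase-finite m n) (rowFrom? i j) z ≈
             ext z i (j ℕ.+ 0) + sumOver (staircase-finite m n) (rowFrom? i (suc j)) z
      peel rewrite ℕ.+-identityʳ j with at? m n i j
      ... | yes (u , u∈@(r , c)) =
        sumOver-insert (staircase-finite m n) (rowFrom? i j) (rowFrom? i (suc j)) u
          (r , ℕ.≤-reflexive (≡.sym c)) (λ { (_ , lt) → ℕ.<⇒≢ lt (≡.sym c) }) from
          (λ { (r , lt) → r , ℕ.<⇒≤ lt }) z
        where
        from : ∀ {f} → rowFrom i j f → f ≡ u ⊎ rowFrom i (suc j) f
        from {f} (r , le) with ℕ.m≤n⇒m<n∨m≡n le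
        ... | inj₁ lt = inj₂ (r , lt)
        ... | inj₂ e  = inj₁ (At-unique (r , ≡.sym e) u∈)
      ... | no ∄ =
        trans (sumOver-≐ (staircase-finite m n) (rowFrom? i j) (rowFrom? i (suc j))
                 ((λ {f} → from {f}) , λ { (r , lt) → r , ℕ.<⇒≤ lt }) z)
              (sym (+-identityˡ _))
        where
        from : ∀ {f} → rowFrom i j f → rowFrom i (suc j) f
        from {f} (r , le) with ℕ.m≤n⇒m<n∨m≡n le
        ... | inj₁ lt = r , lt
        ... | inj₂ e  = ⊥-elim (∄ (f , r , ≡.sym e))

  module _ {p q : ℕ} where

    private
      rowOf colOf : Node p q → ℕ
      rowOf (grid u) = toℕ (row u)
      rowOf _        = 0
      colOf (grid u) = toℕ (col u)
      colOf _        = 0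

      grid-≡⁺ : ∀ (u v : Staircase (suc p) (suc q)) → At (toℕ (row v)) (toℕ (col v)) u → grid u ≡ grid v
      grid-≡⁺ u v u∈ = ≡.cong grid (At-unique u∈ (≡.refl , ≡.refl))

    enter : Point (Arc p q) → ℕ → ℕ → Carrier
    enter y = nodeFlow (y start) (ext (y ∘ down)) (ext (y ∘ diag))

    module _ (q≤p : q ℕ.≤ p) (y : Point (Arc p q)) where

      private
        module ArcSum {ℓ} (N : Pred (Arc p q) ℓ) (N? : Decidable N) where

          sumOver-arc-≈ : ∀ {α β γ δ} →
            (if does (N? start) then y start else 0#) ≈ α →
            sumOver (staircase-finite p (suc q)) (N? ∘ down) (y ∘ down) ≈ β →
            sumOver (staircase-finite p q) (N? ∘ diag) (y ∘ diag) ≈ γ →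
            sumOver (fin-finite (suc q)) (N? ∘ end) (y ∘ end) ≈ δ →
            sumOver (arc-finite p q) N? y ≈ α + (β + (γ + δ))
          sumOver-arc-≈ a b c d = trans (sumOver-arc N? y) (+-cong a (+-cong b (+-cong c d)))

          start-∈ : N start → (if does (N? start) then y start else 0#) ≈ y start
          start-∈ h = reflexive (≡.cong (λ b → if b then y start else 0#) (dec-true (N? start) h))

          start-∉ : ¬ N start → (if does (N? start) then y start else 0#) ≈ 0#
          start-∉ h = reflexive (≡.cong (λ b → if b then y start else 0#) (dec-false (N? start) h))

          down-∅ : (∀ u → ¬ N (down u)) →
                   sumOver (staircase-finite p (suc q)) (N? ∘ down) (y ∘ down) ≈ 0#
          down-∅ h = sumOver-∅ (staircase-finite p (suc q)) (N? ∘ down) h (y ∘ down)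

          diag-∅ : (∀ u → ¬ N (diag u)) →
                   sumOver (staircase-finite p q) (N? ∘ diag) (y ∘ diag) ≈ 0#
          diag-∅ h = sumOver-∅ (staircase-finite p q) (N? ∘ diag) h (y ∘ diag)

          end-∅ : (∀ j → ¬ N (end j)) →
                  sumOver (fin-finite (suc q)) (N? ∘ end) (y ∘ end) ≈ 0#
          end-∅ h = sumOver-∅ (fin-finite (suc q)) (N? ∘ end) h (y ∘ end)

          down-At : ∀ i j → (∀ u → N (down u) → At i j u) → (∀ u → At i j u → N (down u)) →
                    sumOver (staircase-finite p (suc q)) (N? ∘ down) (y ∘ down) ≈ ext (y ∘ down) i j
          down-At i j to from = sumOver-At (y ∘ down) (N? ∘ down) i j ((λ {u} → to u) , (λ {u} → from u))

          diag-At : ∀ i j → (∀ u → N (diag u) → At i j u) → (∀ u → At i j u → N (diag u)) →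
                    sumOver (staircase-finite p q) (N? ∘ diag) (y ∘ diag) ≈ ext (y ∘ diag) i j
          diag-At i j to from = sumOver-At (y ∘ diag) (N? ∘ diag) i j ((λ {u} → to u) , (λ {u} → from u))

        module InSum (v : Staircase (suc p) (suc q)) =
          ArcSum (λ a → arcHead a ≡ grid v) (λ a → arcHead a ≟-node grid v)

        module OutSum (v : Node p q) =
          ArcSum (λ a → arcTail q≤p a ≡ v) (λ a → arcTail q≤p a ≟-node v)

      inflow-grid : ∀ v → inflow p q q≤p y (grid v) ≈ enter y (toℕ (row v)) (toℕ (col v))
      inflow-grid v@(⟨ zero , zero ⟩[ _ ]) =
        trans (sumOver-arc-≈ (start-∈ ≡.refl) (down-∅ λ _ ()) (diag-∅ λ _ ()) (end-∅ λ _ ()))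
              (solve 1 (λ a → a ⊕ (id ⊕ (id ⊕ id)) ⊜ a) refl _)
        where open InSum v
      inflow-grid v@(⟨ zero , suc j ⟩[ _ ]) =
        trans (sumOver-arc-≈ (start-∉ λ ()) (down-∅ λ _ ()) (diag-∅ λ _ ()) (end-∅ λ _ ()))
              (solve 0 (id ⊕ (id ⊕ (id ⊕ id)) ⊜ id) refl)
        where open InSum v
      inflow-grid v@(⟨ suc i , zero ⟩[ _ ]) =
        trans (sumOver-arc-≈ (start-∉ λ ())
                 (down-At (toℕ i) 0
                    (λ u e → ℕ.suc-injective (≡.cong rowOf e) , ≡.cong colOf e)
                    (λ { u (r , c) → grid-≡⁺ _ _ (≡.cong suc r , c) }))
                 (diag-∅ λ _ ()) (end-∅ λ _ ()))
              (solve 1 (λ a → id ⊕ (a ⊕ (id ⊕ id)) ⊜ a) refl _)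
        where open InSum v
      inflow-grid v@(⟨ suc i , suc j ⟩[ _ ]) =
        trans (sumOver-arc-≈ (start-∉ λ ())
                 (down-At (toℕ i) (suc (toℕ j))
                    (λ u e → ℕ.suc-injective (≡.cong rowOf e) , ≡.cong colOf e)
                    (λ { u (r , c) → grid-≡⁺ _ _ (≡.cong suc r , c) }))
                 (diag-At (toℕ i) (toℕ j)
                    (λ u e → ℕ.suc-injective (≡.cong rowOf e) , ℕ.suc-injective (≡.cong colOf e))
                    (λ { u (r , c) → grid-≡⁺ _ _ (≡.cong suc r , ≡.cong suc c) }))
                 (end-∅ λ _ ()))
              (solve 2 (λ a b → id ⊕ (a ⊕ (b ⊕ id)) ⊜ a ⊕ b) refl _ _)
        where open InSum v

      outflow-s : outflow p q q≤p y s ≈ y start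
      outflow-s =
        trans (sumOver-arc-≈ refl (down-∅ λ _ ()) (diag-∅ λ _ ()) (end-∅ λ _ ()))
              (solve 1 (λ a → a ⊕ (id ⊕ (id ⊕ id)) ⊜ a) refl _)
        where open OutSum s

      outflow-grid : ∀ v → toℕ (row v) ℕ.< p → outflow p q q≤p y (grid v) ≈
                     ext (y ∘ diag) (toℕ (row v)) (toℕ (col v)) + ext (y ∘ down) (toℕ (row v)) (toℕ (col v))
      outflow-grid v row<p =
        trans (sumOver-arc-≈ refl
                 (down-At (toℕ (row v)) (toℕ (col v))
                    (λ u e → ≡.trans (≡.sym (Fin.toℕ-inject₁ (row u))) (≡.cong rowOf e) , ≡.cong colOf e)
                    (λ { u (r , c) → grid-≡⁺ _ _ (≡.trans (Fin.toℕ-inject₁ (row u)) r , c) }))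
                 (diag-At (toℕ (row v)) (toℕ (col v))
                    (λ u e → ≡.trans (≡.sym (Fin.toℕ-inject₁ (row u))) (≡.cong rowOf e)
                           , ≡.trans (≡.sym (Fin.toℕ-inject₁ (col u))) (≡.cong colOf e))
                    (λ { u (r , c) → grid-≡⁺ _ _ (≡.trans (Fin.toℕ-inject₁ (row u)) r
                                                , ≡.trans (Fin.toℕ-inject₁ (col u)) c) }))
                 (end-∅ λ j e → ℕ.<⇒≢ row<p (≡.trans (≡.sym (≡.cong rowOf e)) (Fin.toℕ-fromℕ p))))
              (solve 2 (λ a b → id ⊕ (a ⊕ (b ⊕ id)) ⊜ b ⊕ a) refl _ _)
        where open OutSum (grid v)

      outflow-last : ∀ v → toℕ (row v) ≡ p → outflow p q q≤p y (grid v) ≈ y (end (col v))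
      outflow-last v row≡p =
        trans (sumOver-arc-≈ refl
                 (down-∅ λ u e → inner (row u) (≡.cong rowOf e))
                 (diag-∅ λ u e → inner (row u) (≡.cong rowOf e))
                 (sumOver-single (fin-finite (suc q)) (λ j → arcTail q≤p (end j) ≟-node grid v) (col v)
                    (grid-≡⁺ _ _ (≡.trans (Fin.toℕ-fromℕ p) (≡.sym row≡p) , ≡.refl))
                    (λ e → Fin.toℕ-injective (≡.cong colOf e)) (y ∘ end)))
              (solve 1 (λ a → id ⊕ (id ⊕ (id ⊕ a)) ⊜ a) refl _)
        where
        open OutSum (grid v)
        inner : ∀ (i : Fin p) → ¬ (toℕ (inject₁ i) ≡ toℕ (row v))
        inner i e = ℕ.<⇒≢ (Fin.toℕ<n i)
          (≡.trans (≡.sym (Fin.toℕ-inject₁ i)) (≡.trans e row≡p))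

      -- A diagonal arc into node column j + 1 starts in column j, so its tail is never in the set,
      -- and its head is automatically on or below the diagonal. Entry row i is node row i + 1,
      -- whence the `suc`.
      sumOver-in↘-col : ∀ e → sumOver (arc-finite p q) (in↘? q≤p (colNodes? e)) y ≈
                              colSum (ext (y ∘ diag)) (suc (toℕ (row e))) (toℕ (col e))
      sumOver-in↘-col e =
        trans (sumOver-arc-≈ (start-∉ λ { (() , _) }) (down-∅ λ { _ (() , _) })
                 (trans (sumOver-≐ (staircase-finite p q) (λ u → in↘? q≤p (colNodes? e) (diag u))
                           (colBelow? (suc (toℕ (row e))) (toℕ (col e))) ((λ {u} → to u) , (λ {u} → from u)) (y ∘ diag))
                        (sumOver-colBelow (y ∘ diag) (suc (toℕ (row e))) (toℕ (col e))))
                 (end-∅ λ { _ (() , _) }))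
              (solve 1 (λ a → id ⊕ (id ⊕ (a ⊕ id)) ⊜ a) refl _)
        where
        open ArcSum (in↘ q≤p (colNodes e)) (in↘? q≤p (colNodes? e))
        to : ∀ u → in↘ q≤p (colNodes e) (diag u) → colBelow (suc (toℕ (row e))) (toℕ (col e)) u
        to u (_ , (c , _ , r) , _) = r , ℕ.suc-injective c
        from : ∀ u → colBelow (suc (toℕ (row e))) (toℕ (col e)) u → in↘ q≤p (colNodes e) (diag u)
        from u (r , c) = tt
          , (≡.cong suc c , s≤s (ℕ.≤-trans (ℕ.≤-reflexive (≡.sym c)) (col≤row′ u)) , r)
          , λ { (c′ , _) → ℕ.1+n≢n (≡.trans (≡.sym c′) (≡.trans (Fin.toℕ-inject₁ (col u)) c)) }

  sumOver-bar : ∀ {p q} (x : Point (ℐ p q)) e d → toℕ (col e) ℕ.+ d ≡ q →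
                sumOver (staircase-finite p q) (bar? e) x ≈ Σ< d (λ l → ext x (toℕ (row e)) (toℕ (col e) ℕ.+ l))
  sumOver-bar {p} {q} x e d eq =
    trans (sumOver-≐ (staircase-finite p q) (bar? e) (rowFrom? (toℕ (row e)) (toℕ (col e)))
             ((λ { (r , c) → ≡.cong toℕ r , c }) , (λ { (r , c) → Fin.toℕ-injective r , c })) x)
          (sumOver-rowFrom x (toℕ (row e)) (toℕ (col e)) d eq)

-- Path prefixes with chosen entries, and their matrices

-- An initial path in the digraph from (0 , 0) to (i , k), together with a choice
-- of at most one entry in each of the rows passed: a diagonal arc forces
-- the entry at its head, a vertical arc in column k allows every column up to k.
-- Entries are indexed from 0 and nodes are not, whence l < k in put.
data Prefix : ℕ → ℕ → Set where
  ε     : Prefix 0 0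
  advance : ∀ {i k} → Prefix i k → Prefix (suc i) (suc k)
  skip  : ∀ {i k} → Prefix i k → Prefix (suc i) k
  put   : ∀ {i k} l → l ℕ.< k → Prefix i k → Prefix (suc i) k

insert : ℕ → ℕ → (ℕ → Maybe ℕ) → ℕ → Maybe ℕ
insert i l c r = if does (r ℕ.≟ i) then just l else c r

choice : ∀ {i k} → Prefix i k → ℕ → Maybe ℕ
choice ε                   = λ _ → nothing
choice (advance {i} {k} π)   = insert i k (choice π)
choice (skip π)            = choice π
choice (put {i} l _ π)     = insert i l (choice π)

insert-≡ : ∀ i l c → insert i l c i ≡ just l
insert-≡ i l c = ≡.cong (λ b → if b then just l else c i) (dec-true (i ℕ.≟ i) ≡.refl)

insert-≢ : ∀ i l c {r} → r ≢ i → insert i l c r ≡ c r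
insert-≢ i l c {r} r≢i = ≡.cong (λ b → if b then just l else c r) (dec-false (r ℕ.≟ i) r≢i)

choice-beyond : ∀ {i k} (π : Prefix i k) {r} → i ℕ.≤ r → choice π r ≡ nothing
choice-beyond ε _ = ≡.refl
choice-beyond (advance {i} {k} π) lt = ≡.trans (insert-≢ i k (choice π) (ℕ.<⇒≢ lt ∘ ≡.sym)) (choice-beyond π (ℕ.<⇒≤ lt))
choice-beyond (skip π) lt = choice-beyond π (ℕ.<⇒≤ lt)
choice-beyond (put {i} l _ π) lt = ≡.trans (insert-≢ i l (choice π) (ℕ.<⇒≢ lt ∘ ≡.sym)) (choice-beyond π (ℕ.<⇒≤ lt))

Opened : (ℕ → Maybe ℕ) → ℕ → ℕ → Set
Opened c i j = ∃ λ r → r ℕ.< i × c r ≡ just j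

module _ {i k : ℕ} (π : Prefix i k) (l : ℕ) where

  insert-opened : ∀ {r j} → r ℕ.≤ i → Opened (choice π) r j → Opened (insert i l (choice π)) r j
  insert-opened r≤i (r′ , r′<r , eq) =
    r′ , r′<r , ≡.trans (insert-≢ i l (choice π) (ℕ.<⇒≢ (ℕ.<-≤-trans r′<r r≤i))) eq

opened-suc : ∀ {c i j} → Opened c i j → Opened c (suc i) j
opened-suc (r , r<i , eq) = r , ℕ.m<n⇒m<1+n r<i , eq

-- Only diagonal arcs increase the column, and the arc into node column j + 1 places a 1 in entry
-- column j; later choices concern later rows and leave it alone.
choice-opened : ∀ {i k} (π : Prefix i k) {j} → j ℕ.< k → Opened (choice π) i j
choice-opened (advance {i} {k} π) {j} (s≤s j≤k) with ℕ.m≤n⇒m<n∨m≡n j≤k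
... | inj₁ j<k    = opened-suc (insert-opened π k ℕ.≤-refl (choice-opened π j<k))
... | inj₂ ≡.refl = i , ℕ.n<1+n i , insert-≡ i k (choice π)
choice-opened (skip π)     j<k = opened-suc (choice-opened π j<k)
choice-opened (put l _ π) j<k = opened-suc (insert-opened π l ℕ.≤-refl (choice-opened π j<k))

-- When an entry l is added, the prefix is in a column k ≥ l and all entry columns below k are open;
-- earlier rows are untouched, so their entries keep the property. The bound l ≤ k covers both
-- `advance`, where l = k, and `put`.
choice-ordered : ∀ {i k} (π : Prefix i k) {r l j} → choice π r ≡ just l → j ℕ.< l → Opened (choice π) r j
insert-ordered : ∀ {i k} (π : Prefix i k) {l} → l ℕ.≤ k → ∀ {r m j} →
                 insert i l (choice π) r ≡ just m → j ℕ.< m → Opened (insert i l (choice π)) r j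
insert-ordered {i} π {l} l≤k {r} eq j<m with r ℕ.≟ i
... | yes ≡.refl with ≡.refl ← ≡.trans (≡.sym (insert-≡ i l (choice π))) eq = insert-opened π l ℕ.≤-refl (choice-opened π (ℕ.<-≤-trans j<m l≤k))
... | no  r≢i with r ℕ.≤? i
...   | yes r≤i = insert-opened π l r≤i (choice-ordered π (≡.trans (≡.sym (insert-≢ i l (choice π) r≢i)) eq) j<m)
...   | no  r≰i with () ← ≡.trans (≡.sym eq) (≡.trans (insert-≢ i l (choice π) r≢i) (choice-beyond π (ℕ.≰⇒≥ r≰i)))
choice-ordered (advance π)     = insert-ordered π ℕ.≤-refl
choice-ordered (skip π)      = choice-ordered π
choice-ordered (put l l<k π) = insert-ordered π (ℕ.<⇒≤ l<k)

-- No 1 of `b` can sit in the top row. If `a` has one there, the comparison is settled; otherwise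
-- the columns agree there and all witnesses lie below.
lex-≤ : ∀ {n} (b a : Fin n → Bool) → (∀ r → b r ≡ true → ∃ λ r′ → r′ Fin.< r × a r′ ≡ true) →
        Lex-≤ _≡_ Bool._≤_ (Vec.tabulate b) (Vec.tabulate a)
lex-≤ {zero}  b a h = base tt
lex-≤ {suc n} b a h with b zero in b₀ | a zero in a₀
... | true  | _     with () ← proj₁ (proj₂ (h zero b₀))
... | false | true  = this (Bool.f≤t , λ ()) ≡.refl
... | false | false = next ≡.refl (lex-≤ (b ∘ suc) (a ∘ suc) later)
  where
  later : ∀ r → b (suc r) ≡ true → ∃ λ r′ → r′ Fin.< r × a (suc r′) ≡ true
  later r br with h (suc r) br
  ... | zero   , _       , eq with () ← ≡.trans (≡.sym a₀) eq
  ... | suc r′ , s≤s lt , eq = r′ , lt , eq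

chosen : Maybe ℕ → ℕ → Bool
chosen nothing  j = false
chosen (just l) j = does (j ℕ.≟ l)

chosen⁻ : ∀ m {j} → chosen m j ≡ true → m ≡ just j
chosen⁻ (just l) {j} h with j ℕ.≟ l
... | yes ≡.refl = ≡.refl
... | no  j≢l with () ← ≡.trans (≡.sym h) (dec-false (j ℕ.≟ l) j≢l)

chosen⁺ : ∀ {m j} → m ≡ just j → chosen m j ≡ true
chosen⁺ {j = j} ≡.refl = dec-true (j ℕ.≟ j) ≡.refl

module _ {p q k : ℕ} (π : Prefix p k) where

  -- Nothing bounds k by q: a choice in a column ≥ q just leaves its row zero, so every prefix of
  -- length p yields a matrix of the orbitope.
  matrix : 01-Matrix p q
  matrix r j = chosen (choice π (toℕ r)) (toℕ j)

  matrix-atMostOne : AtMostOneOnePerRow matrix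
  matrix-atMostOne r {j} {l} h h′ = Fin.toℕ-injective
    (just-injective (≡.trans (≡.sym (chosen⁻ (choice π (toℕ r)) h)) (chosen⁻ (choice π (toℕ r)) h′)))

  matrix-lex : LexDecreasingColumns matrix
  matrix-lex {j} {l} j<l = lex-≤ _ _ earlier
    where
    earlier : ∀ r → matrix r l ≡ true → ∃ λ r′ → r′ Fin.< r × matrix r′ j ≡ true
    earlier r h with r′ , r′<r , eq ← choice-ordered π (chosen⁻ (choice π (toℕ r)) h) j<l =
      Fin.fromℕ< r′<p , ≡.subst (ℕ._< toℕ r) (≡.sym (Fin.toℕ-fromℕ< r′<p)) r′<r
        , ≡.trans (≡.cong (λ n → chosen (choice π n) (toℕ j)) (Fin.toℕ-fromℕ< r′<p)) (chosen⁺ eq)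
      where
      r′<p : r′ ℕ.< p
      r′<p = ℕ.<-trans r′<r (Fin.toℕ<n r)

-- Measures on path prefixes

module Cones {c ℓ₁ ℓ₂} (K : OrderedField c ℓ₁ ℓ₂) where
  open OrderedFieldProperties K

  Table : Set c
  Table = ℕ → ℕ → Carrier

  indicator : Bool → Carrier
  indicator b = if b then 1# else 0#

  unit : ℕ → ℕ → Table
  unit i l r j = indicator (does (r ℕ.≟ i) ∧ does (j ℕ.≟ l))

  unit-row≢ : ∀ {i r} → r ≢ i → ∀ l j → unit i l r j ≡ 0#
  unit-row≢ {i} {r} r≢i l j = ≡.cong (λ b → indicator (b ∧ does (j ℕ.≟ l))) (dec-false (r ℕ.≟ i) r≢i)

  unit-row≡ : ∀ i l j → unit i l i j ≡ indicator (does (j ℕ.≟ l))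
  unit-row≡ i l j = ≡.cong (λ b → indicator (b ∧ does (j ℕ.≟ l))) (dec-true (i ℕ.≟ i) ≡.refl)

  *-unit-row≢ : ∀ a {i r} → r ≢ i → ∀ l j → a * unit i l r j ≈ 0#
  *-unit-row≢ a r≢i l j = trans (*-congˡ (reflexive (unit-row≢ r≢i l j))) (zeroʳ a)

  *-unit-col≢ : ∀ a i {l j} → j ≢ l → a * unit i l i j ≈ 0#
  *-unit-col≢ a i {l} {j} j≢l = trans
    (*-congˡ (reflexive (≡.trans (unit-row≡ i l j) (≡.cong indicator (dec-false (j ℕ.≟ l) j≢l))))) (zeroʳ a)

  unit-self : ∀ i l → unit i l i l ≡ 1#
  unit-self i l = ≡.cong₂ (λ a b → indicator (a ∧ b)) (dec-true (i ℕ.≟ i) ≡.refl) (dec-true (l ℕ.≟ l) ≡.refl)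

  table : ∀ {i k} → Prefix i k → Table
  table π r j = indicator (chosen (choice π r) j)

  -- Row i of a prefix of length i is still empty, so overwriting it amounts to adding a matrix
  -- unit, the same one for all prefixes that receive the entry.
  table-insert : ∀ {i k} (π : Prefix i k) l r j →
                 indicator (chosen (insert i l (choice π) r) j) ≈ table π r j + unit i l r j
  table-insert {i} π l r j with r ℕ.≟ i
  ... | yes ≡.refl = begin
    indicator (chosen (insert i l (choice π) i) j)
      ≡⟨ ≡.cong (λ m → indicator (chosen m j)) (insert-≡ i l (choice π)) ⟩
    indicator (does (j ℕ.≟ l))
      ≡⟨ unit-row≡ i l j ⟨
    unit i l i j
      ≈⟨ +-identityˡ _ ⟨
    0# + unit i l i j
      ≡⟨ ≡.cong (λ m → indicator (chosen m j) + unit i l i j) (choice-beyond π (ℕ.≤-refl {i})) ⟨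
    table π i j + unit i l i j ∎
    where open ≈-Reasoning
  ... | no r≢i = begin
    indicator (chosen (insert i l (choice π) r) j)
      ≡⟨ ≡.cong (λ m → indicator (chosen m j)) (insert-≢ i l (choice π) r≢i) ⟩
    table π r j
      ≈⟨ +-identityʳ _ ⟨
    table π r j + 0#
      ≡⟨ ≡.cong (table π r j +_) (unit-row≢ r≢i l j) ⟨
    table π r j + unit i l r j ∎
    where open ≈-Reasoning

  -- A finite list of weighted atoms, visible from outside only through its total weight `m` and its
  -- weighted sum `v`. Equality is built into the constructors, so that both indices can be
  -- rewritten freely.
  data Cone {I : Set} (pt : I → Table) : Carrier → Table → Set (c ⊔ ℓ₁ ⊔ ℓ₂) where
    nil  : ∀ {m v} → m ≈ 0# → (∀ r j → v r j ≈ 0#) → Cone pt m v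
    cons : ∀ w i {m v m′ v′} → 0# ≼ w → Cone pt m v → m′ ≈ w + m →
           (∀ r j → v′ r j ≈ w * pt i r j + v r j) → Cone pt m′ v′

  module _ {I : Set} {pt : I → Table} where

    Cone-resp : ∀ {m m′ v v′} → m′ ≈ m → (∀ r j → v′ r j ≈ v r j) → Cone pt m v → Cone pt m′ v′
    Cone-resp hm hv (nil m≈ v≈) = nil (trans hm m≈) (λ r j → trans (hv r j) (v≈ r j))
    Cone-resp hm hv (cons w i 0≼w C m≈ v≈) = cons w i 0≼w C (trans hm m≈) (λ r j → trans (hv r j) (v≈ r j))

    Cone-+ : ∀ {m m′ v v′} → Cone pt m v → Cone pt m′ v′ → Cone pt (m + m′) (λ r j → v r j + v′ r j)
    Cone-+ (nil m≈ v≈) D = Cone-resp (trans (+-congʳ m≈) (+-identityˡ _))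
                                     (λ r j → trans (+-congʳ (v≈ r j)) (+-identityˡ _)) D
    Cone-+ (cons w i 0≼w C m≈ v≈) D = cons w i 0≼w (Cone-+ C D)
      (trans (+-congʳ m≈) (+-assoc _ _ _)) (λ r j → trans (+-congʳ (v≈ r j)) (+-assoc _ _ _))

    Cone-Σ< : ∀ n {m : ℕ → Carrier} {v : ℕ → Table} → (∀ k → Cone pt (m k) (v k)) →
              Cone pt (Σ< n m) (λ r j → Σ< n (λ k → v k r j))
    Cone-Σ< zero    C = nil refl (λ _ _ → refl)
    Cone-Σ< (suc n) C = Cone-+ (C 0) (Cone-Σ< n (C ∘ suc))

    -- The list of atoms is cut at cumulative weight `m₁`: whole atoms are handed to the first part
    -- as long as they fit.
    Cone-split : ∀ {m v m₁ m₂} → Cone pt m v → 0# ≼ m₁ → 0# ≼ m₂ → m ≈ m₁ + m₂ →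
                 Σ Table λ v₁ → Σ Table λ v₂ → Cone pt m₁ v₁ × Cone pt m₂ v₂ × (∀ r j → v r j ≈ v₁ r j + v₂ r j)
    Cone-split {m₁ = m₁} {m₂} (nil m≈ v≈) 0≼m₁ 0≼m₂ m≈m₁+m₂ =
      (λ _ _ → 0#) , (λ _ _ → 0#)
      , nil (+≈0⇒≈0 0≼m₁ 0≼m₂ m₁+m₂≈0) (λ _ _ → refl)
      , nil (+≈0⇒≈0 0≼m₂ 0≼m₁ (trans (+-comm m₂ m₁) m₁+m₂≈0)) (λ _ _ → refl)
      , λ r j → trans (v≈ r j) (sym (+-identityˡ _))
      where
      m₁+m₂≈0 : m₁ + m₂ ≈ 0#
      m₁+m₂≈0 = trans (sym m≈m₁+m₂) m≈
    Cone-split {m₁ = m₁} {m₂} (cons w i {m} {v} 0≼w C m≈ v≈) 0≼m₁ 0≼m₂ m≈m₁+m₂ with ≼-total w m₁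
    ... | inj₁ w≼m₁
        with e , 0≼e , w+e≈m₁ ← ≼⇒∃+ w≼m₁
        with v₁ , v₂ , C₁ , C₂ , v≈v₁+v₂ ← Cone-split {m₁ = e} {m₂} C 0≼e 0≼m₂
               (+-cancelˡ w _ _ (trans (sym m≈) (trans m≈m₁+m₂ (trans (+-congʳ (sym w+e≈m₁)) (+-assoc w e m₂)))))
        = (λ r j → w * pt i r j + v₁ r j) , v₂
        , cons w i 0≼w C₁ (sym w+e≈m₁) (λ _ _ → refl) , C₂
        , λ r j → trans (v≈ r j) (trans (+-congˡ (v≈v₁+v₂ r j)) (sym (+-assoc _ _ _)))
    -- The atom that straddles the cut: `m₁` of its weight completes the first part, and the rest
    -- `e` joins all later atoms in the second.
    ... | inj₂ m₁≼w
        with e , 0≼e , m₁+e≈w ← ≼⇒∃+ m₁≼w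
        = (λ r j → m₁ * pt i r j) , (λ r j → e * pt i r j + v r j)
        , cons m₁ i 0≼m₁ (nil refl (λ _ _ → refl)) (sym (+-identityʳ m₁)) (λ r j → sym (+-identityʳ _))
        , cons e i 0≼e C
            (+-cancelˡ m₁ _ _ (trans (sym m≈m₁+m₂) (trans m≈ (trans (+-congʳ (sym m₁+e≈w)) (+-assoc m₁ e m)))))
            (λ _ _ → refl)
        , λ r j → trans (v≈ r j) (trans (+-congʳ (trans (*-congʳ (sym m₁+e≈w)) (distribʳ _ m₁ e))) (+-assoc _ _ _))

    -- Entries of the atoms lie between 0 and 1, so those of `v` lie between 0 and `m`. This
    -- disposes of the share of a measure that is assigned to a nonexistent diagonal arc.
    Cone-null : (∀ i r j → 0# ≼ pt i r j) → (∀ i r j → pt i r j ≼ 1#) →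
                ∀ {m v} → Cone pt m v → m ≈ 0# → ∀ r j → v r j ≈ 0#
    Cone-null 0≼pt pt≼1 C m≈0 r j =
      ≼-antisym (≼-respʳ-≈ m≈0 (proj₂ (bounds C))) (proj₁ (bounds C))
      where
      bounds : ∀ {m v} → Cone pt m v → 0# ≼ v r j × v r j ≼ m
      bounds (nil m≈ v≈) = ≼-reflexive (sym (v≈ r j)) , ≼-reflexive (trans (v≈ r j) (sym m≈))
      bounds (cons w i 0≼w C m≈ v≈) with 0≼v , v≼m ← bounds C =
        ≼-respʳ-≈ (sym (v≈ r j)) (+-nonNegative (*-nonNegative 0≼w (0≼pt i r j)) 0≼v)
        , ≼-respˡ-≈ (sym (v≈ r j)) (≼-respʳ-≈ (sym m≈)
            (+-mono-≼ (≼-respʳ-≈ (*-identityʳ w) (*-monoˡ-≼ 0≼w (pt≼1 i r j))) v≼m))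

    Cone⇒combination : ∀ {m v} → Cone pt m v →
      Σ ℕ λ n → Σ (Fin n → Carrier) λ μ → Σ (Fin n → I) λ is →
        (∀ k → 0# ≼ μ k) × sum μ ≈ m × (∀ r j → v r j ≈ sum (λ k → μ k * pt (is k) r j))
    Cone⇒combination (nil m≈ v≈) = 0 , (λ ()) , (λ ()) , (λ ()) , sym m≈ , v≈
    Cone⇒combination (cons w i 0≼w C m≈ v≈) with n , μ , is , 0≼μ , Σμ , v≈Σ ← Cone⇒combination C =
      suc n , (w ◂ μ) , (i ◂ is) , (λ { zero → 0≼w ; (suc k) → 0≼μ k })
      , trans (+-congˡ Σμ) (sym m≈) , λ r j → trans (v≈ r j) (+-congˡ (v≈Σ r j))

  -- The shift `u` is the same for all atoms, so it contributes `u` times the total mass.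
  Cone-map : ∀ {I J : Set} {pt : I → Table} {pt′ : J → Table} (f : I → J) (u : Table) →
             (∀ i r j → pt′ (f i) r j ≈ pt i r j + u r j) →
             ∀ {m v} → Cone pt m v → Cone pt′ m (λ r j → v r j + m * u r j)
  Cone-map f u h (nil m≈ v≈) =
    nil m≈ (λ r j → trans (+-cong (v≈ r j) (trans (*-congʳ m≈) (zeroˡ _))) (+-identityˡ _))
  Cone-map {pt = pt} {pt′} f u h {m′} {v′} (cons w i {m} {v} 0≼w C m≈ v≈) = cons w (f i) 0≼w (Cone-map f u h C) m≈ λ r j → begin
    v′ r j + m′ * u r j                                ≈⟨ +-cong (v≈ r j) (trans (*-congʳ m≈) (distribʳ _ _ _)) ⟩
    (w * pt i r j + v r j) + (w * u r j + m * u r j)   ≈⟨ solve 4 (λ a b c d → (a ⊕ b) ⊕ (c ⊕ d) ⊜ (a ⊕ c) ⊕ (b ⊕ d)) refl _ _ _ _ ⟩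
    (w * pt i r j + w * u r j) + (v r j + m * u r j)   ≈⟨ +-congʳ (trans (*-congˡ (h i r j)) (distribˡ _ _ _)) ⟨
    w * pt′ (f i) r j + (v r j + m * u r j)            ∎
    where open ≈-Reasoning

  Cone-relabel : ∀ {I J : Set} {pt : I → Table} {pt′ : J → Table} (f : I → J) →
                 (∀ i r j → pt′ (f i) r j ≈ pt i r j) → ∀ {m v} → Cone pt m v → Cone pt′ m v
  Cone-relabel f h (nil m≈ v≈) = nil m≈ v≈
  Cone-relabel f h (cons w i 0≼w C m≈ v≈) =
    cons w (f i) 0≼w (Cone-relabel f h C) m≈ (λ r j → trans (v≈ r j) (+-congʳ (*-congˡ (sym (h i r j)))))

  Prefixes : ℕ → ℕ → Carrier → Table → Set (c ⊔ ℓ₁ ⊔ ℓ₂)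
  Prefixes i k = Cone (table {i} {k})

  indicator-bounds : ∀ b → 0# ≼ indicator b × indicator b ≼ 1#
  indicator-bounds true  = 0≼1 , ≼-refl
  indicator-bounds false = ≼-refl , 0≼1

  Prefixes-null : ∀ {i k m v} → Prefixes i k m v → m ≈ 0# → ∀ r j → v r j ≈ 0#
  Prefixes-null = Cone-null (λ π r j → proj₁ (indicator-bounds (chosen (choice π r) j)))
                            (λ π r j → proj₂ (indicator-bounds (chosen (choice π r) j)))

  Prefixes-advance : ∀ {i k m v} → Prefixes i k m v → Prefixes (suc i) (suc k) m (λ r j → v r j + m * unit i k r j)
  Prefixes-advance {i} {k} = Cone-map advance (unit i k) (λ π → table-insert π k)

  -- A share `z l` of the measure is cut off for each l and extended by `put`; what is left over
  -- takes `skip`. The columns are passed as `loc` because the recursion renumbers the shares.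
  Prefixes-place : ∀ {i k} n (loc : ℕ → ℕ) (z : ℕ → Carrier) → (∀ l → 0# ≼ z l) →
                   (∀ l → loc l ℕ.< k ⊎ z l ≈ 0#) → ∀ {m v} → Σ< n z ≼ m → Prefixes i k m v →
                   Prefixes (suc i) k m (λ r j → v r j + Σ< n (λ l → z l * unit i (loc l) r j))
  Prefixes-place zero loc z 0≼z h _ C =
    Cone-resp refl (λ r j → +-identityʳ _) (Cone-relabel skip (λ _ _ _ → refl) C)
  Prefixes-place {i} {k} (suc n) loc z 0≼z h {m} {v} Σz≼m C
    with e , 0≼e , z₀+e≈m ← ≼⇒∃+ {z 0} {m} (≼-trans (x≼x+y (z 0) (sum-nonNegative {n} (λ l → 0≼z (suc (toℕ l))))) Σz≼m)
    with v₁ , v₂ , C₁ , C₂ , v≈ ← Cone-split C (0≼z 0) 0≼e (sym z₀+e≈m)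
    = Cone-resp (sym z₀+e≈m) regroup (Cone-+ (first (h 0)) rest)
    where
    first : loc 0 ℕ.< k ⊎ z 0 ≈ 0# → Prefixes (suc i) k (z 0) (λ r j → v₁ r j + z 0 * unit i (loc 0) r j)
    first (inj₁ lt)   = Cone-map (put (loc 0) lt) (unit i (loc 0)) (λ π → table-insert π (loc 0)) C₁
    -- A share that may not be placed has mass zero, so extending it by `skip` instead changes
    -- nothing.
    first (inj₂ z₀≈0) = Cone-resp refl (λ r j → trans (+-congˡ (trans (*-congʳ z₀≈0) (zeroˡ _))) (+-identityʳ _))
                                  (Cone-relabel skip (λ _ _ _ → refl) C₁)
    rest : Prefixes (suc i) k e (λ r j → v₂ r j + Σ< n (λ l → z (suc l) * unit i (loc (suc l)) r j))
    rest = Prefixes-place n (loc ∘ suc) (z ∘ suc) (0≼z ∘ suc) (h ∘ suc)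
             (+-cancelʳ-≼ (z 0) (≼-respˡ-≈ (+-comm _ _) (≼-respʳ-≈ (trans (sym z₀+e≈m) (+-comm _ _)) Σz≼m))) C₂
    regroup : ∀ r j → v r j + Σ< (suc n) (λ l → z l * unit i (loc l) r j) ≈ _
    regroup r j = trans (+-congʳ (v≈ r j))
                        (solve 4 (λ a b c d → (a ⊕ b) ⊕ (c ⊕ d) ⊜ (a ⊕ c) ⊕ (b ⊕ d)) refl _ _ _ _)

-- Decomposition of a flow, together with x, into complete prefixes

module Decompositions {c ℓ₁ ℓ₂} (K : OrderedField c ℓ₁ ℓ₂) where
  open OrderedFieldProperties K
  open FlowSums K
  open Cones K

  module Decomposition
    (p q : ℕ) (σ : Carrier) (d g x : Table)
    (σ≈1     : σ ≈ 1#)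
    (0≼d     : ∀ i k → 0# ≼ d i k)
    (0≼g     : ∀ i k → 0# ≼ g i k)
    (g≈0     : ∀ i → g i q ≈ 0#)
    (conserve : ∀ {i} → i ℕ.< p → ∀ k → nodeFlow σ d g i k ≈ g i k + d i k)
    (g≼x     : ∀ i j → g i j ≼ x i j)
    (bar≼col : ∀ {i} → i ℕ.< p → ∀ j n → j ℕ.+ n ≡ q → Σ< n (λ l → x i (j ℕ.+ l)) ≼ colSum g (suc i) j)
    where

    Y : Table
    Y = nodeFlow σ d g

    -- Only diagonal arcs enter the columns beyond j, so the flow found there in
    -- row i is the one that has crossed into column j + 1 so far.
    colSum≈tail : ∀ i → i ℕ.≤ p → ∀ j n → j ℕ.+ n ≡ q → colSum g i j ≈ Σ< n (λ l → Y i (suc (j ℕ.+ l)))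
    colSum≈tail zero    _   j n eq = sym (Σ<-zero n (λ _ _ → refl))
    colSum≈tail (suc i) i<p j n eq = begin
      colSum g i j + g i j
        ≈⟨ +-congʳ (colSum≈tail i (ℕ.<⇒≤ i<p) j n eq) ⟩
      Σ< n (λ l → Y i (suc (j ℕ.+ l))) + g i j
        ≈⟨ +-congʳ (Σ<-cong n (λ l _ → conserve i<p (suc (j ℕ.+ l)))) ⟩
      Σ< n (λ l → g i (suc (j ℕ.+ l)) + d i (suc (j ℕ.+ l))) + g i j
        ≈⟨ +-congʳ (Σ<-distrib-+ n (λ l → g i (suc (j ℕ.+ l))) (λ l → d i (suc (j ℕ.+ l)))) ⟩
      (Σ< n (λ l → g i (suc (j ℕ.+ l))) + D) + g i j
        ≈⟨ solve 3 (λ a b c → (a ⊕ b) ⊕ c ⊜ b ⊕ (c ⊕ a)) refl _ _ _ ⟩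
      D + (g i j + Σ< n (λ l → g i (suc (j ℕ.+ l))))
        ≈⟨ +-congˡ (+-cong (reflexive (≡.cong (g i) (≡.sym (ℕ.+-identityʳ j))))
                           (Σ<-cong n (λ l _ → reflexive (≡.cong (g i) (≡.sym (ℕ.+-suc j l)))))) ⟩
      D + (g i (j ℕ.+ 0) + Σ< n (λ l → g i (j ℕ.+ suc l)))
        ≈⟨ +-congˡ (Σ<-shift n (λ l → g i (j ℕ.+ l))) ⟩
      D + (Σ< n (λ l → g i (j ℕ.+ l)) + g i (j ℕ.+ n))
        ≈⟨ +-congˡ (trans (+-congˡ (trans (reflexive (≡.cong (g i) eq)) (g≈0 i))) (+-identityʳ _)) ⟩
      D + Σ< n (λ l → g i (j ℕ.+ l))
        ≈⟨ Σ<-distrib-+ n (λ l → d i (suc (j ℕ.+ l))) (λ l → g i (j ℕ.+ l)) ⟨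
      Σ< n (λ l → Y (suc i) (suc (j ℕ.+ l)))  ∎
      where
      open ≈-Reasoning
      D : Carrier
      D = Σ< n (λ l → d i (suc (j ℕ.+ l)))

    -- Each row is a cut: arcs between grid nodes go down exactly one row, so the unit that enters
    -- (0 , 0) reaches every row undiminished.
    rowFlow : ∀ i → i ℕ.≤ p → Σ< (suc q) (Y i) ≈ 1#
    rowFlow zero    _   = trans (+-cong σ≈1 (Σ<-zero q (λ _ _ → refl))) (+-identityʳ 1#)
    rowFlow (suc i) i<p = begin
      d i 0 + Σ< q (λ k → d i (suc k) + g i k)
        ≈⟨ +-congˡ (Σ<-distrib-+ q (d i ∘ suc) (g i)) ⟩
      d i 0 + (Σ< q (d i ∘ suc) + Σ< q (g i))
        ≈⟨ +-congˡ (+-congˡ (trans (Σ<-shift q (g i)) (trans (+-congˡ (g≈0 i)) (+-identityʳ _)))) ⟨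
      d i 0 + (Σ< q (d i ∘ suc) + Σ< (suc q) (g i))
        ≈⟨ solve 3 (λ a b c → a ⊕ (b ⊕ c) ⊜ c ⊕ (a ⊕ b)) refl _ _ _ ⟩
      Σ< (suc q) (g i) + Σ< (suc q) (d i)
        ≈⟨ Σ<-distrib-+ (suc q) (g i) (d i) ⟨
      Σ< (suc q) (λ k → g i k + d i k)
        ≈⟨ Σ<-cong (suc q) (λ k _ → conserve i<p k) ⟨
      Σ< (suc q) (Y i)
        ≈⟨ rowFlow i (ℕ.<⇒≤ i<p) ⟩
      1#  ∎
      where open ≈-Reasoning

    -- The first i rows of x, written through matrix units because this is the form in which a step
    -- adds a row to the measures.
    firstRows : ℕ → Table
    firstRows zero    r j = 0#
    firstRows (suc i) r j = firstRows i r j + Σ< q (λ l → x i l * unit i l r j)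

    -- The induction invariant: the measure at node (i , k) carries exactly the flow through that
    -- node, and the measures together reproduce the rows of x passed so far.
    record Stage (i : ℕ) : Set (c ⊔ ℓ₁ ⊔ ℓ₂) where
      field
        part  : ℕ → Table
        cone  : ∀ k → Prefixes i k (Y i k) (part k)
        total : ∀ r j → Σ< (suc q) (λ k → part k r j) ≈ firstRows i r j

    start-stage : Stage 0
    start-stage = record
      { part  = λ _ _ _ → 0#
      ; cone  = λ { zero    → cons σ ε (≼-respʳ-≈ (sym σ≈1) 0≼1) (nil refl (λ _ _ → refl)) (sym (+-identityʳ σ))
                                (λ _ _ → sym (trans (+-identityʳ _) (zeroʳ σ)))
                  ; (suc k) → nil refl (λ _ _ → refl) }
      ; total = λ _ _ → Σ<-zero (suc q) (λ _ _ → refl)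
      }

    module Step {i} (i<p : i ℕ.< p) (S : Stage i) where
      open Stage S

      residual : ∀ l → ∃ λ a → 0# ≼ a × g i l + a ≈ x i l
      residual l = ≼⇒∃+ (g≼x i l)

      a : ℕ → Carrier
      a l = proj₁ (residual l)

      -- The entries forced by diagonal arcs and the diagonal flow that arrives with them are the
      -- same sum of `g`; cancelling it from (b) leaves residual demand against vertical flow.
      tails : ∀ j n → j ℕ.+ n ≡ q → Σ< n (λ l → a (j ℕ.+ l)) ≼ Σ< n (λ l → d i (suc (j ℕ.+ l)))
      tails j n eq = +-cancelʳ-≼ (Σ< n (λ l → g i (j ℕ.+ l))) (begin
        Σ< n (λ l → a (j ℕ.+ l)) + Σ< n (λ l → g i (j ℕ.+ l))
          ≈⟨ +-comm _ _ ⟩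
        Σ< n (λ l → g i (j ℕ.+ l)) + Σ< n (λ l → a (j ℕ.+ l))
          ≈⟨ Σ<-distrib-+ n (λ l → g i (j ℕ.+ l)) (λ l → a (j ℕ.+ l)) ⟨
        Σ< n (λ l → g i (j ℕ.+ l) + a (j ℕ.+ l))
          ≈⟨ Σ<-cong n (λ l _ → proj₂ (proj₂ (residual (j ℕ.+ l)))) ⟩
        Σ< n (λ l → x i (j ℕ.+ l))
          ≤⟨ bar≼col i<p j n eq ⟩
        colSum g (suc i) j
          ≈⟨ colSum≈tail (suc i) i<p j n eq ⟩
        Σ< n (λ l → d i (suc (j ℕ.+ l)) + g i (j ℕ.+ l))
          ≈⟨ Σ<-distrib-+ n (λ l → d i (suc (j ℕ.+ l))) (λ l → g i (j ℕ.+ l)) ⟩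
        Σ< n (λ l → d i (suc (j ℕ.+ l))) + Σ< n (λ l → g i (j ℕ.+ l))  ∎)
        where open ≼-Reasoning

      -- Supplier k is the vertical arc in node column k + 1, where the entry columns l ≤ k are
      -- open. Node column 0 has no open entry column and stays out of the transportation problem.
      plan : Σ Table λ z → (∀ k l → 0# ≼ z k l)
                         × (∀ k l → k ℕ.< l → z k l ≈ 0#)
                         × (∀ l → l ℕ.< q → Σ< q (λ k → z k l) ≈ a l)
                         × (∀ k → Σ< q (z k) ≼ d i (suc k))
      plan = transport q a (d i ∘ suc) (λ l → proj₁ (proj₂ (residual l))) (λ k → 0≼d i (suc k)) tails

      -- The part of the flow on the vertical arc of column k that places the 1 in column l.
      z : Table
      z zero    l = 0#
      z (suc k) l = proj₁ plan k l

      0≼z : ∀ k l → 0# ≼ z k l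
      0≼z zero    l = ≼-refl
      0≼z (suc k) l = proj₁ (proj₂ plan) k l

      z-support : ∀ k l → l ℕ.< k ⊎ z k l ≈ 0#
      z-support zero    l = inj₂ refl
      z-support (suc k) l with l ℕ.≤? k
      ... | yes l≤k = inj₁ (s≤s l≤k)
      ... | no  l≰k = inj₂ (proj₁ (proj₂ (proj₂ plan)) k l (ℕ.≰⇒> l≰k))

      z-row : ∀ k → Σ< q (z k) ≼ d i k
      z-row zero    = ≼-respˡ-≈ (sym (Σ<-zero q (λ _ _ → refl))) (0≼d i 0)
      z-row (suc k) = proj₂ (proj₂ (proj₂ (proj₂ plan))) k

      z-col : ∀ l → l ℕ.< q → Σ< (suc q) (λ k → z k l) ≈ a l
      z-col l l<q = trans (+-identityˡ _) (proj₁ (proj₂ (proj₂ (proj₂ plan))) l l<q)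

      halves : ∀ k → Σ Table λ v₁ → Σ Table λ v₂ → Prefixes i k (g i k) v₁ × Prefixes i k (d i k) v₂
                                                  × (∀ r j → part k r j ≈ v₁ r j + v₂ r j)
      halves k = Cone-split (cone k) (0≼g i k) (0≼d i k) (conserve i<p k)

      v₁ v₂ : ℕ → Table
      v₁ k = proj₁ (halves k)
      v₂ k = proj₁ (proj₂ (halves k))

      entered placed : ℕ → Table
      entered k r j = v₁ k r j + g i k * unit i k r j
      placed  k r j = v₂ k r j + Σ< q (λ l → z k l * unit i l r j)

      entered-cone : ∀ k → Prefixes (suc i) (suc k) (g i k) (entered k)
      entered-cone k = Prefixes-advance (proj₁ (proj₂ (proj₂ (halves k))))

      placed-cone : ∀ k → Prefixes (suc i) k (d i k) (placed k)
      placed-cone k = Prefixes-place q (λ l → l) (z k) (0≼z k) (z-support k) (z-row k)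
                        (proj₁ (proj₂ (proj₂ (proj₂ (halves k)))))

      part⁺ : ℕ → Table
      part⁺ zero    = placed 0
      part⁺ (suc k) = λ r j → placed (suc k) r j + entered k r j

      cone⁺ : ∀ k → Prefixes (suc i) k (Y (suc i) k) (part⁺ k)
      cone⁺ zero    = placed-cone 0
      cone⁺ (suc k) = Cone-+ (placed-cone (suc k)) (entered-cone k)

      module _ (r j : ℕ) where
        open ≈-Reasoning

        u : ℕ → Carrier
        u l = unit i l r j

        Σ-part : Σ< (suc q) (λ k → part k r j) ≈ Σ< q (λ k → v₁ k r j) + Σ< (suc q) (λ k → v₂ k r j)
        Σ-part = begin
          Σ< (suc q) (λ k → part k r j)
            ≈⟨ Σ<-cong (suc q) (λ k _ → proj₂ (proj₂ (proj₂ (proj₂ (halves k)))) r j) ⟩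
          Σ< (suc q) (λ k → v₁ k r j + v₂ k r j)
            ≈⟨ Σ<-distrib-+ (suc q) (λ k → v₁ k r j) (λ k → v₂ k r j) ⟩
          Σ< (suc q) (λ k → v₁ k r j) + Σ< (suc q) (λ k → v₂ k r j)
            ≈⟨ +-congʳ (Σ<-shift q (λ k → v₁ k r j)) ⟩
          (Σ< q (λ k → v₁ k r j) + v₁ q r j) + Σ< (suc q) (λ k → v₂ k r j)
            -- No diagonal arc leaves column q: that half has mass zero, hence a zero table.
            ≈⟨ +-congʳ (trans (+-congˡ (Prefixes-null (proj₁ (proj₂ (proj₂ (halves q)))) (g≈0 i) r j)) (+-identityʳ _)) ⟩
          Σ< q (λ k → v₁ k r j) + Σ< (suc q) (λ k → v₂ k r j)  ∎

        Σ-placements : Σ< (suc q) (λ k → Σ< q (λ l → z k l * u l)) ≈ Σ< q (λ l → a l * u l)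
        Σ-placements = begin
          Σ< (suc q) (λ k → Σ< q (λ l → z k l * u l))
            ≈⟨ Σ<-swap (suc q) q (λ k l → z k l * u l) ⟩
          Σ< q (λ l → Σ< (suc q) (λ k → z k l * u l))
            ≈⟨ Σ<-cong q (λ l l<q → trans (Σ<-*-distribʳ (suc q) (λ k → z k l) (u l)) (*-congʳ (z-col l l<q))) ⟩
          Σ< q (λ l → a l * u l)  ∎

        Σ-row : Σ< q (λ l → a l * u l) + Σ< q (λ l → g i l * u l) ≈ Σ< q (λ l → x i l * u l)
        Σ-row = begin
          Σ< q (λ l → a l * u l) + Σ< q (λ l → g i l * u l)
            ≈⟨ Σ<-distrib-+ q (λ l → a l * u l) (λ l → g i l * u l) ⟨
          Σ< q (λ l → a l * u l + g i l * u l)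
            ≈⟨ Σ<-cong q (λ l _ → trans (sym (distribʳ (u l) (a l) (g i l)))
                                        (*-congʳ (trans (+-comm _ _) (proj₂ (proj₂ (residual l)))))) ⟩
          Σ< q (λ l → x i l * u l)  ∎

        total⁺ : Σ< (suc q) (λ k → part⁺ k r j) ≈ firstRows (suc i) r j
        total⁺ = begin
          placed 0 r j + Σ< q (λ k → placed (suc k) r j + entered k r j)
            ≈⟨ +-congˡ (Σ<-distrib-+ q (λ k → placed (suc k) r j) (λ k → entered k r j)) ⟩
          placed 0 r j + (Σ< q (λ k → placed (suc k) r j) + Σ< q (λ k → entered k r j))
            ≈⟨ +-assoc _ _ _ ⟨
          Σ< (suc q) (λ k → placed k r j) + Σ< q (λ k → entered k r j)
            ≈⟨ +-cong (Σ<-distrib-+ (suc q) (λ k → v₂ k r j) (λ k → Σ< q (λ l → z k l * u l)))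
                      (Σ<-distrib-+ q (λ k → v₁ k r j) (λ k → g i k * u k)) ⟩
          (V₂ + Σ< (suc q) (λ k → Σ< q (λ l → z k l * u l))) + (V₁ + Σ< q (λ k → g i k * u k))
            ≈⟨ +-congʳ (+-congˡ Σ-placements) ⟩
          (V₂ + Σ< q (λ l → a l * u l)) + (V₁ + Σ< q (λ k → g i k * u k))
            -- The two halves recombine to the old measures, the placed and the forced entries to
            -- row i of x.
            ≈⟨ solve 4 (λ a b c d → (a ⊕ b) ⊕ (c ⊕ d) ⊜ (c ⊕ a) ⊕ (b ⊕ d)) refl _ _ _ _ ⟩
          (V₁ + V₂) + (Σ< q (λ l → a l * u l) + Σ< q (λ k → g i k * u k))
            ≈⟨ +-cong (trans (sym Σ-part) (total r j)) Σ-row ⟩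
          firstRows i r j + Σ< q (λ l → x i l * u l)  ∎
          where
          V₁ V₂ : Carrier
          V₁ = Σ< q (λ k → v₁ k r j)
          V₂ = Σ< (suc q) (λ k → v₂ k r j)

      next-stage : Stage (suc i)
      next-stage = record { part = part⁺ ; cone = cone⁺ ; total = total⁺ }

    stage : ∀ i → i ℕ.≤ p → Stage i
    stage zero    _   = start-stage
    stage (suc i) i<p = Step.next-stage i<p (stage i (ℕ.<⇒≤ i<p))

    Σ<-unit : ∀ n (f : ℕ → Carrier) i j → j ℕ.< n → Σ< n (λ l → f l * unit i l i j) ≈ f j
    Σ<-unit (suc n) f i zero    _ =
      trans (+-cong (trans (*-congˡ (reflexive (unit-self i 0))) (*-identityʳ _))
                    (Σ<-zero n {λ l → f (suc l) * unit i (suc l) i 0} (λ l _ → *-unit-col≢ (f (suc l)) i {suc l} {0} (λ ()))))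
            (+-identityʳ _)
    Σ<-unit (suc n) f i (suc j) (s≤s j<n) =
      trans (+-cong (*-unit-col≢ (f 0) i {0} {suc j} (λ ()))
               (trans (Σ<-cong n (λ l _ → *-congˡ {f (suc l)} (shift l))) (Σ<-unit n (f ∘ suc) i j j<n)))
            (+-identityˡ _)
      where
      shift : ∀ l → unit i (suc l) i (suc j) ≈ unit i l i j
      shift l = reflexive (≡.trans (unit-row≡ i (suc l) (suc j)) (≡.sym (unit-row≡ i l j)))

    firstRows-other : ∀ i {r} → r ≢ i → ∀ j → firstRows (suc i) r j ≈ firstRows i r j
    firstRows-other i r≢i j =
      trans (+-congˡ (Σ<-zero q (λ l _ → *-unit-row≢ (x i l) r≢i l j))) (+-identityʳ _)

    firstRows-after : ∀ i {r} → i ℕ.≤ r → ∀ j → firstRows i r j ≈ 0#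
    firstRows-after zero    _   j = refl
    firstRows-after (suc i) i<r j =
      trans (firstRows-other i (ℕ.<⇒≢ i<r ∘ ≡.sym) j) (firstRows-after i (ℕ.<⇒≤ i<r) j)

    firstRows-before : ∀ i {r j} → r ℕ.< i → j ℕ.< q → firstRows i r j ≈ x r j
    firstRows-before (suc i) {r} {j} (s≤s r≤i) j<q with ℕ.m≤n⇒m<n∨m≡n r≤i
    ... | inj₁ r<i    = trans (firstRows-other i (ℕ.<⇒≢ r<i) j) (firstRows-before i r<i j<q)
    ... | inj₂ ≡.refl = trans (+-cong (firstRows-after r ℕ.≤-refl j) (Σ<-unit q (x r) r j j<q)) (+-identityˡ _)

    decomposition : ∃ λ v → Cone {I = ∃ (Prefix p)} (λ (_ , π) → table π) 1# v
                          × (∀ r j → r ℕ.< p → j ℕ.< q → x r j ≈ v r j)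
    decomposition = (λ r j → Σ< (suc q) (λ k → part k r j))
      , Cone-resp (sym (rowFlow p ℕ.≤-refl)) (λ _ _ → refl)
          (Cone-Σ< (suc q) (λ k → Cone-relabel (k ,_) (λ _ _ _ → refl) (cone k)))
      , λ r j r<p j<q → trans (sym (firstRows-before p r<p j<q)) (sym (total r j))
      where open Stage (stage p ℕ.≤-refl)

-- The projection lies in the orbitope

module _ {c ℓ₁ ℓ₂} (K : OrderedField c ℓ₁ ℓ₂) {p q : ℕ} (q≤p : q ℕ.≤ p) where
  open OrderedFieldProperties K
  open Polyhedra K
  open FiniteSums K
  open FlowSums K
  open Cones K

  polytope⊆orbitope : ∀ {x} → projection (extendedPolytope p q q≤p) x → packingOrbitope p q x
  polytope⊆orbitope {x} (y , (0≼y , conserved , unit-out) , diag≼x , bar≼in) =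
    combine D.decomposition
    where
    σ≈1 : y start ≈ 1#
    σ≈1 = trans (sym (outflow-s q≤p y)) unit-out

    d g : ℕ → ℕ → Carrier
    d = ext (y ∘ down)
    g = ext (y ∘ diag)

    conserve-at : ∀ v → toℕ (row v) ℕ.< p →
                  enter y (toℕ (row v)) (toℕ (col v)) ≈
                  g (toℕ (row v)) (toℕ (col v)) + d (toℕ (row v)) (toℕ (col v))
    conserve-at v row<p = trans (sym (inflow-grid q≤p y v))
      (trans (conserved (grid v) (λ ()) (λ ())) (outflow-grid q≤p y v row<p))

    zeros : ∀ {a b} → a ≡ 0# → b ≡ 0# → a + b ≈ 0#
    zeros a≡0 b≡0 = trans (+-cong (reflexive a≡0) (reflexive b≡0)) (+-identityˡ 0#)

    enter-upper : ∀ {i k} → i ℕ.< k → enter y i k ≈ 0#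
    enter-upper {zero}  {suc k} _         = refl
    enter-upper {suc i} {suc k} (s≤s i<k) = zeros (ext-col> (y ∘ down) (ℕ.m<n⇒m<1+n i<k)) (ext-col> (y ∘ diag) i<k)

    enter-right : ∀ {i k} → suc q ℕ.≤ k → enter y i k ≈ 0#
    enter-right {zero}  {suc k} _         = refl
    enter-right {suc i} {suc k} (s≤s q≤k) = zeros (ext-col≥ (y ∘ down) (s≤s q≤k)) (ext-col≥ (y ∘ diag) q≤k)

    -- Conservation is given at nodes only; off the grid every term is zero.
    conserve : ∀ {i} → i ℕ.< p → ∀ k → enter y i k ≈ g i k + d i k
    conserve {i} i<p k with i ℕ.<? k | suc q ℕ.≤? k
    ... | yes i<k | _       = trans (enter-upper {i} {k} i<k) (sym (zeros (ext-col> (y ∘ diag) i<k) (ext-col> (y ∘ down) i<k)))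
    ... | no _    | yes q<k = trans (enter-right {i} {k} q<k) (sym (zeros (ext-col≥ (y ∘ diag) (ℕ.<⇒≤ q<k)) (ext-col≥ (y ∘ down) q<k)))
    ... | no i≮k  | no q≮k  with v , ≡.refl , ≡.refl ← inside {suc p} {suc q} (ℕ.m<n⇒m<1+n i<p) (ℕ.≰⇒> q≮k) (ℕ.≮⇒≥ i≮k)
                            = conserve-at v i<p

    colSum≽0 : ∀ i j → 0# ≼ colSum g i j
    colSum≽0 zero    j = ≼-refl
    colSum≽0 (suc i) j = +-nonNegative (colSum≽0 i j) (ext-elim (y ∘ diag) (0# ≼_) ≼-refl (λ u → 0≼y (diag u)) i j)

    -- (b) is given for staircase indices only. For any other j the left side consists of zeros, and
    -- the right side is a sum of nonnegative flows.
    bar≼col : ∀ {i} → i ℕ.< p → ∀ j n → j ℕ.+ n ≡ q → Σ< n (λ l → ext x i (j ℕ.+ l)) ≼ colSum g (suc i) j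
    bar≼col {i} i<p j n eq with i ℕ.<? j | q ℕ.≤? j
    ... | yes i<j | _ = ≼-respˡ-≈
      (sym (Σ<-zero n (λ l _ → reflexive (ext-col> x (ℕ.<-≤-trans i<j (ℕ.m≤m+n j l)))))) (colSum≽0 (suc i) j)
    ... | no _ | yes q≤j = ≼-respˡ-≈
      (sym (Σ<-zero n (λ l _ → reflexive (ext-col≥ x (ℕ.≤-trans q≤j (ℕ.m≤m+n j l)))))) (colSum≽0 (suc i) j)
    ... | no i≮j | no q≰j with e , ≡.refl , ≡.refl ← inside {p} {q} i<p (ℕ.≰⇒> q≰j) (ℕ.≮⇒≥ i≮j)
        = ≼-respˡ-≈ (sumOver-bar x e n eq) (≼-respʳ-≈ (sumOver-in↘-col q≤p y e) (bar≼in e))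

    module D = Decompositions.Decomposition K p q (y start) d g (ext x) σ≈1
      (ext-elim (y ∘ down) (0# ≼_) ≼-refl (λ u → 0≼y (down u)))
      (ext-elim (y ∘ diag) (0# ≼_) ≼-refl (λ u → 0≼y (diag u)))
      (λ i → reflexive (ext-col≥ (y ∘ diag) ℕ.≤-refl))
      conserve (ext-mono diag≼x) bar≼col

    combine : (∃ λ v → Cone {I = ∃ (Prefix p)} (λ (_ , π) → table π) 1# v
                     × (∀ r j → r ℕ.< p → j ℕ.< q → ext x r j ≈ v r j)) → packingOrbitope p q x
    combine (v , C , x≈v) with n , μ , π , 0≼μ , Σμ , v≈Σ ← Cone⇒combination C =
      n , μ , (λ k → entries p q (matrix (proj₂ (π k)))) , 0≼μ , Σμ
      , (λ k → matrix (proj₂ (π k)) , (λ {i} {j} → matrix-lex (proj₂ (π k)) {i} {j}) , matrix-atMostOne (proj₂ (π k)) , λ _ → refl)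
      , λ e → trans (reflexive (≡.sym (ext-at x e)))
                (trans (x≈v _ _ (Fin.toℕ<n (row e)) (Fin.toℕ<n (col e))) (v≈Σ _ _))

-- The path traced by an orbitope matrix

-- At the first difference `a` has a 1, and above row i it has none. So the columns agree above row
-- i, and there `b` cannot exceed `a`.
lex-≤-first : ∀ {n} {b a : Fin n → Bool} → Lex-≤ _≡_ Bool._≤_ (Vec.tabulate b) (Vec.tabulate a) →
              ∀ i → b i ≡ true → (∀ r → r Fin.< i → a r ≡ false) → a i ≡ true
lex-≤-first {suc n} {b} {a} (this (b≤a , b≢a) _) zero b₀ _ with b zero | a zero | b≤a
... | true | true | Bool.b≤b = ≡.refl
lex-≤-first {suc n} (next b₀≡a₀ _) zero b₀ _ = ≡.trans (≡.sym b₀≡a₀) b₀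
lex-≤-first {suc n} {b} {a} (this (b≤a , b≢a) _) (suc i) _ a-before with b zero | a zero | b≤a | a-before zero ℕ.z<s
... | _ | false | Bool.b≤b | _ = ⊥-elim (b≢a ≡.refl)
lex-≤-first {suc n} (next _ lex) (suc i) bᵢ a-before = lex-≤-first lex i bᵢ (λ r r<i → a-before (suc r) (s≤s r<i))

module Path {p q : ℕ} (M : 01-Matrix p q) (lex : LexDecreasingColumns M) (amo : AtMostOneOnePerRow M) where

  M̂ : ℕ → ℕ → Bool
  M̂ i j with i ℕ.<? p | j ℕ.<? q
  ... | yes i<p | yes j<q = M (Fin.fromℕ< i<p) (Fin.fromℕ< j<q)
  ... | _       | _       = false

  M̂-inside : ∀ i j → M̂ (toℕ i) (toℕ j) ≡ M i j
  M̂-inside i j with toℕ i ℕ.<? p | toℕ j ℕ.<? q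
  ... | yes i<p | yes j<q = ≡.cong₂ M (Fin.fromℕ<-toℕ i i<p) (Fin.fromℕ<-toℕ j j<q)
  ... | no i≮p  | _       = ⊥-elim (i≮p (Fin.toℕ<n i))
  ... | yes _   | no j≮q  = ⊥-elim (j≮q (Fin.toℕ<n j))

  M̂-true : ∀ {i j} → M̂ i j ≡ true →
           Σ (Fin p) λ i′ → Σ (Fin q) λ j′ → toℕ i′ ≡ i × toℕ j′ ≡ j × M i′ j′ ≡ true
  M̂-true {i} {j} h with i ℕ.<? p | j ℕ.<? q
  ... | yes i<p | yes j<q = _ , _ , Fin.toℕ-fromℕ< i<p , Fin.toℕ-fromℕ< j<q , h

  -- The column of the path in row i: the number of columns with a 1 above row i.
  column-at : ℕ → ℕ
  column-at zero    = 0
  column-at (suc i) = if M̂ i (column-at i) then suc (column-at i) else column-at i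

  advances : ℕ → Bool
  advances i = M̂ i (column-at i)

  column-at-mono : ∀ {i r} → i ℕ.≤ r → column-at i ℕ.≤ column-at r
  column-at-mono i≤r = go (ℕ.≤⇒≤′ i≤r)
    where
    step : ∀ r → column-at r ℕ.≤ column-at (suc r)
    step r with advances r
    ... | true  = ℕ.n≤1+n _
    ... | false = ℕ.≤-refl
    go : ∀ {i r} → i ℕ.≤′ r → column-at i ℕ.≤ column-at r
    go ℕ.≤′-refl         = ℕ.≤-refl
    go (ℕ.≤′-step i≤′r) = ℕ.≤-trans (go i≤′r) (step _)

  column-at≤row : ∀ i → column-at i ℕ.≤ i
  column-at≤row zero = ℕ.z≤n
  column-at≤row (suc i) with advances i
  ... | true  = s≤s (column-at≤row i)
  ... | false = ℕ.m≤n⇒m≤1+n (column-at≤row i)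

  M̂-right : ∀ {i j} → q ℕ.≤ j → M̂ i j ≡ false
  M̂-right {i} {j} q≤j with M̂ i j in eq
  ... | false = ≡.refl
  ... | true  with _ , j′ , _ , ≡.refl , _ ← M̂-true {i} {j} eq = ⊥-elim (ℕ.<⇒≱ (Fin.toℕ<n j′) q≤j)

  column-at≤q : ∀ i → column-at i ℕ.≤ q
  column-at≤q zero = ℕ.z≤n
  column-at≤q (suc i) with advances i in eq
  ... | false = column-at≤q i
  ... | true  with _ , j′ , _ , j′≡ , _ ← M̂-true {i} {column-at i} eq =
    ℕ.≤-trans (s≤s (ℕ.≤-reflexive (≡.sym j′≡))) (Fin.toℕ<n j′)

  advance-column : ∀ {i} → advances i ≡ true → column-at (suc i) ≡ suc (column-at i)
  advance-column h rewrite h = ≡.refl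

  -- If a 1 of row i lay to the right of column-at i, then that column, being empty above,
  -- could not precede it lexicographically unless it had a second 1 in row i.
  support : ∀ i {j} → M̂ i j ≡ true → j ℕ.< column-at (suc i)
  support = <-rec (λ i → ∀ {j} → M̂ i j ≡ true → j ℕ.< column-at (suc i)) go
    where
    go : ∀ i → (∀ {r} → r ℕ.< i → ∀ {j} → M̂ r j ≡ true → j ℕ.< column-at (suc r)) →
         ∀ {j} → M̂ i j ≡ true → j ℕ.< column-at (suc i)
    go i above {j} h with ℕ.<-cmp j (column-at i)
    ... | tri< j<c _ _    = ℕ.<-≤-trans j<c (column-at-mono (ℕ.n≤1+n i))
    ... | tri≈ _ ≡.refl _ = ℕ.≤-reflexive (≡.sym (advance-column h))
    ... | tri> _ _ c<j
        with i′ , j′ , ≡.refl , ≡.refl , Mij ← M̂-true {i} {j} h = ⊥-elim (ℕ.<⇒≢ c<j (≡.trans (≡.sym c′≡) (≡.cong toℕ (amo i′ Mic Mij))))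
        where
        c<q : column-at (toℕ i′) ℕ.< q
        c<q = ℕ.<-trans c<j (Fin.toℕ<n j′)
        c′ : Fin q
        c′ = Fin.fromℕ< c<q
        c′≡ : toℕ c′ ≡ column-at (toℕ i′)
        c′≡ = Fin.toℕ-fromℕ< c<q
        empty-above : ∀ r → r Fin.< i′ → M r c′ ≡ false
        empty-above r r<i with M r c′ in eq
        ... | false = ≡.refl
        -- By induction a 1 in row r would put the path beyond column `c′` right after row r, but it
        -- is still in that column at row i.
        ... | true  = ⊥-elim (ℕ.<⇒≱ (above r<i (≡.trans (M̂-inside r c′) eq))
                               (ℕ.≤-trans (column-at-mono r<i) (ℕ.≤-reflexive (≡.sym c′≡))))
        Mic : M i′ c′ ≡ true
        Mic = lex-≤-first (lex (≡.subst (ℕ._< toℕ j′) (≡.sym c′≡) c<j)) i′ Mij empty-above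

  -- A 1 of row i lies to the left of `column-at (suc i)`, and the path has advanced at most i + 1
  -- times by then. Thus the entries missing from `ℐ` are indeed zero.
  M̂-upper : ∀ {i j} → i ℕ.< j → M̂ i j ≡ false
  M̂-upper {i} {j} i<j with M̂ i j in eq
  ... | false = ≡.refl
  ... | true  = ⊥-elim (ℕ.<⇒≱ (support i eq) (ℕ.≤-trans (column-at≤row (suc i)) i<j))

  M̂-row : ∀ {i j k} → M̂ i j ≡ true → M̂ i k ≡ true → j ≡ k
  M̂-row {i} {j} {k} h h′ with M̂-true {i} {j} h | M̂-true {i} {k} h′
  ... | r , _ , r≡ , ≡.refl , Mj | r′ , _ , r′≡ , ≡.refl , Mk
      with ≡.refl ← Fin.toℕ-injective (≡.trans r≡ (≡.sym r′≡)) = ≡.cong toℕ (amo r Mj Mk)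

-- The indicator flow of the path satisfies all constraints

module Vertex {c ℓ₁ ℓ₂} (K : OrderedField c ℓ₁ ℓ₂) {p q : ℕ} (q≤p : q ℕ.≤ p)
  (M : 01-Matrix p q) (lex : LexDecreasingColumns M) (amo : AtMostOneOnePerRow M) where
  open OrderedFieldProperties K
  open Polyhedra K
  open FiniteSums K
  open FlowSums K
  open Cones K
  open Path M lex amo

  δ : ℕ → ℕ → Bool
  δ j k = does (j ℕ.≟ k)

  verticals diagonals : ℕ → ℕ → Bool
  verticals i k = δ (column-at i) k ∧ not (advances i)
  diagonals i k = δ (column-at i) k ∧ advances i

  pathFlow : Point (Arc p q)
  pathFlow (down u) = indicator (verticals (toℕ (row u)) (toℕ (col u)))
  pathFlow (diag u) = indicator (diagonals (toℕ (row u)) (toℕ (col u)))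
  pathFlow start    = 1#
  pathFlow (end j)  = indicator (δ (column-at p) (toℕ j))

  δ-≢ : ∀ {j k} → j ≢ k → δ j k ≡ false
  δ-≢ {j} {k} = dec-false (j ℕ.≟ k)

  ind : ∀ {b b′} → b ≡ b′ → indicator b ≈ indicator b′
  ind e = reflexive (≡.cong indicator e)

  verticals-≢ : ∀ {i k} → column-at i ≢ k → verticals i k ≡ false
  verticals-≢ {i} c≢k = ≡.cong (_∧ not (advances i)) (δ-≢ c≢k)

  diagonals-≢ : ∀ {i k} → column-at i ≢ k → diagonals i k ≡ false
  diagonals-≢ {i} c≢k = ≡.cong (_∧ advances i) (δ-≢ c≢k)

  ext-down : ∀ {i} → i ℕ.< p → ∀ k → ext (pathFlow ∘ down) i k ≈ indicator (verticals i k)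
  ext-down = ext-table (pathFlow ∘ down) (λ i k → indicator (verticals i k)) (λ _ → refl)
    (λ {i} i<k → ind (verticals-≢ (ℕ.<⇒≢ (ℕ.≤-<-trans (column-at≤row i) i<k))))
    (λ {i} q<k → ind (verticals-≢ (ℕ.<⇒≢ (ℕ.≤-<-trans (column-at≤q i) q<k))))

  ext-diag : ∀ {i} → i ℕ.< p → ∀ k → ext (pathFlow ∘ diag) i k ≈ indicator (diagonals i k)
  ext-diag = ext-table (pathFlow ∘ diag) (λ i k → indicator (diagonals i k)) (λ _ → refl)
    (λ {i} i<k → ind (diagonals-≢ (ℕ.<⇒≢ (ℕ.≤-<-trans (column-at≤row i) i<k))))
    (λ {i} {k} q≤k → ind (right i k q≤k))
    where
    right : ∀ i k → q ℕ.≤ k → diagonals i k ≡ false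
    right i k q≤k with column-at i ℕ.≟ k
    ... | no c≢k  = diagonals-≢ c≢k
    ... | yes c≡k = ≡.trans (≡.cong (δ (column-at i) k ∧_) (M̂-right (ℕ.≤-trans q≤k (ℕ.≤-reflexive (≡.sym c≡k))))) (Bool.∧-zeroʳ _)

  leave-path : ∀ i k → indicator (diagonals i k) + indicator (verticals i k) ≈ indicator (δ (column-at i) k)
  leave-path i k with δ (column-at i) k | advances i
  ... | true  | true  = +-identityʳ _
  ... | true  | false = +-identityˡ _
  ... | false | _     = +-identityˡ _

  -- Combined with `leave-path` this gives conservation: the amounts entering and leaving a node are
  -- both 1 on the path and 0 off it.
  enter-path : ∀ {i} → i ℕ.≤ p → ∀ k → enter pathFlow i k ≈ indicator (δ (column-at i) k)
  enter-path {zero}  _   zero    = refl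
  enter-path {zero}  _   (suc k) = refl
  enter-path {suc i} i<p zero    = trans (ext-down i<p 0) (ind (go (column-at i) (advances i) ))
    where
    go : ∀ c a → δ c 0 ∧ not a ≡ δ (if a then suc c else c) 0
    go c true  = Bool.∧-zeroʳ (δ c 0)
    go c false = Bool.∧-identityʳ (δ c 0)
  enter-path {suc i} i<p (suc k) = trans (+-cong (ext-down i<p (suc k)) (ext-diag i<p k)) (go (column-at i) (advances i))
    where
    go : ∀ c a → indicator (δ c (suc k) ∧ not a) + indicator (δ c k ∧ a) ≈ indicator (δ (if a then suc c else c) (suc k))
    go c true  = trans (+-cong (ind (Bool.∧-zeroʳ (δ c (suc k)))) (ind (Bool.∧-identityʳ (δ c k)))) (+-identityˡ _)
    go c false = trans (+-cong (ind (Bool.∧-identityʳ (δ c (suc k)))) (ind (Bool.∧-zeroʳ (δ c k)))) (+-identityʳ _)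

  pathFlow-conserved : ∀ v → inflow p q q≤p pathFlow (grid v) ≈ outflow p q q≤p pathFlow (grid v)
  pathFlow-conserved v with ℕ.m≤n⇒m<n∨m≡n (Fin.toℕ≤pred[n] (row v))
  ... | inj₁ row<p = begin
    inflow p q q≤p pathFlow (grid v)          ≈⟨ inflow-grid q≤p pathFlow v ⟩
    enter pathFlow i k                        ≈⟨ enter-path (ℕ.<⇒≤ row<p) k ⟩
    indicator (δ (column-at i) k)             ≈⟨ leave-path i k ⟨
    indicator (diagonals i k) + indicator (verticals i k) ≈⟨ +-cong (ext-diag row<p k) (ext-down row<p k) ⟨
    ext (pathFlow ∘ diag) i k + ext (pathFlow ∘ down) i k ≈⟨ outflow-grid q≤p pathFlow v row<p ⟨
    outflow p q q≤p pathFlow (grid v)         ∎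
    where
    open ≈-Reasoning
    i k : ℕ
    i = toℕ (row v)
    k = toℕ (col v)
  ... | inj₂ row≡p = begin
    inflow p q q≤p pathFlow (grid v)            ≈⟨ inflow-grid q≤p pathFlow v ⟩
    enter pathFlow (toℕ (row v)) (toℕ (col v))  ≈⟨ enter-path (ℕ.≤-reflexive row≡p) (toℕ (col v)) ⟩
    indicator (δ (column-at (toℕ (row v))) (toℕ (col v))) ≡⟨ ≡.cong (λ i → indicator (δ (column-at i) (toℕ (col v)))) row≡p ⟩
    pathFlow (end (col v))                      ≈⟨ outflow-last q≤p pathFlow v row≡p ⟨
    outflow p q q≤p pathFlow (grid v)           ∎
    where open ≈-Reasoning

  pathFlow-unit : UnitFlow p q q≤p pathFlow
  pathFlow-unit = nonNegative
    , (λ { (grid v) _ _ → pathFlow-conserved v ; s s≢s _ → ⊥-elim (s≢s ≡.refl) ; t _ t≢t → ⊥-elim (t≢t ≡.refl) })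
    , outflow-s q≤p pathFlow
    where
    nonNegative : ∀ a → 0# ≼ pathFlow a
    nonNegative (down u) = proj₁ (indicator-bounds (verticals (toℕ (row u)) (toℕ (col u))))
    nonNegative (diag u) = proj₁ (indicator-bounds (diagonals (toℕ (row u)) (toℕ (col u))))
    nonNegative start    = 0≼1
    nonNegative (end j)  = proj₁ (indicator-bounds (δ (column-at p) (toℕ j)))

  -- The head of the diagonal arc out of node column c is the entry with 0-based column c, precisely
  -- the one that `advances` inspects.
  diag≼entry : ∀ e → pathFlow (diag e) ≼ entries p q M e
  diag≼entry e with column-at (toℕ (row e)) ℕ.≟ toℕ (col e)
  ... | no c≢k = ≼-respˡ-≈ (sym (ind (diagonals-≢ {toℕ (row e)} c≢k))) (proj₁ (indicator-bounds (M (row e) (col e))))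
  ... | yes c≡k = ≼-reflexive (ind (≡.trans (≡.cong₂ _∧_ (dec-true (column-at (toℕ (row e)) ℕ.≟ toℕ (col e)) c≡k) (≡.cong (M̂ (toℕ (row e))) c≡k))
                                            (M̂-inside (row e) (col e))))

  -- The path never moves left, so it crosses from node column j to j + 1 at most once, and it has
  -- done so by row i exactly if it is beyond j there.
  colSum-path : ∀ i → i ℕ.≤ p → ∀ j → colSum (ext (pathFlow ∘ diag)) i j ≈ indicator (does (j ℕ.<? column-at i))
  colSum-path zero    _   j = refl
  colSum-path (suc i) i<p j =
    trans (+-cong (colSum-path i (ℕ.<⇒≤ i<p) j) (ext-diag i<p j)) (go (column-at i) (advances i))
    where
    go : ∀ c a → indicator (does (j ℕ.<? c)) + indicator (δ c j ∧ a) ≈ indicator (does (j ℕ.<? (if a then suc c else c)))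
    go c false = trans (+-congˡ (ind (Bool.∧-zeroʳ (δ c j)))) (+-identityʳ _)
    go c true with ℕ.<-cmp j c
    ... | tri< j<c j≢c _ = trans (+-cong (ind (dec-true (j ℕ.<? c) j<c)) (ind (≡.cong (_∧ true) (δ-≢ (j≢c ∘ ≡.sym)))))
                             (trans (+-identityʳ _) (sym (ind (dec-true (j ℕ.<? suc c) (ℕ.m<n⇒m<1+n j<c)))))
    ... | tri≈ j≮c j≡c _ = trans (+-cong (ind (dec-false (j ℕ.<? c) j≮c)) (ind (≡.cong (_∧ true) (dec-true (c ℕ.≟ j) (≡.sym j≡c)))))
                             (trans (+-identityˡ _) (sym (ind (dec-true (j ℕ.<? suc c) (s≤s (ℕ.≤-reflexive j≡c))))))
    ... | tri> j≮c j≢c c<j = trans (+-cong (ind (dec-false (j ℕ.<? c) j≮c)) (ind (≡.cong (_∧ true) (δ-≢ (j≢c ∘ ≡.sym)))))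
                             (trans (+-identityʳ _) (sym (ind (dec-false (j ℕ.<? suc c) (ℕ.<⇒≱ (s≤s c<j))))))

  Σ<-indicator≼1 : ∀ n (b : ℕ → Bool) → (∀ {k l} → b k ≡ true → b l ≡ true → k ≡ l) → Σ< n (indicator ∘ b) ≼ 1#
  Σ<-indicator≼1 zero    b _ = 0≼1
  Σ<-indicator≼1 (suc n) b unique with b 0 in b₀
  ... | false = ≼-respˡ-≈ (sym (+-identityˡ _))
                  (Σ<-indicator≼1 n (b ∘ suc) (λ bk bl → ℕ.suc-injective (unique bk bl)))
  ... | true  = ≼-reflexive (trans (+-congˡ (Σ<-zero n (λ k _ → ind (others k)))) (+-identityʳ 1#))
    where
    others : ∀ k → b (suc k) ≡ false
    others k with b (suc k) in bₖ
    ... | false = ≡.refl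
    ... | true  with () ← unique b₀ bₖ

  ext-entries : ∀ {i} → i ℕ.< p → ∀ k → ext (entries p q M) i k ≈ indicator (M̂ i k)
  ext-entries = ext-table (entries p q M) (λ i k → indicator (M̂ i k)) (λ u → sym (ind (M̂-inside (row u) (col u))))
    (λ i<k → ind (M̂-upper i<k)) (λ q≤k → ind (M̂-right q≤k))

  -- If the path is beyond column j after row i, the right side is 1, which bounds any row sum;
  -- otherwise `support` leaves no 1 in the columns from j on.
  bar≼in : ∀ e → sumOver (staircase-finite p q) (bar? e) (entries p q M) ≼
                 sumOver (arc-finite p q) (in↘? q≤p (colNodes? e)) pathFlow
  bar≼in e = ≼-respˡ-≈ (sym bar-sum) (≼-respʳ-≈ (sym in-sum) row-bound)
    where
    i j n : ℕ
    i = toℕ (row e)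
    j = toℕ (col e)
    n = q ℕ.∸ j
    i<p : i ℕ.< p
    i<p = Fin.toℕ<n (row e)
    bar-sum : sumOver (staircase-finite p q) (bar? e) (entries p q M) ≈ Σ< n (λ l → indicator (M̂ i (j ℕ.+ l)))
    bar-sum = trans (sumOver-bar (entries p q M) e n (ℕ.m+[n∸m]≡n (ℕ.<⇒≤ (Fin.toℕ<n (col e)))))
                    (Σ<-cong n (λ l _ → ext-entries i<p (j ℕ.+ l)))
    in-sum : sumOver (arc-finite p q) (in↘? q≤p (colNodes? e)) pathFlow ≈ indicator (does (j ℕ.<? column-at (suc i)))
    in-sum = trans (sumOver-in↘-col q≤p pathFlow e) (colSum-path (suc i) i<p j)
    row-bound : Σ< n (λ l → indicator (M̂ i (j ℕ.+ l))) ≼ indicator (does (j ℕ.<? column-at (suc i)))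
    row-bound with j ℕ.<? column-at (suc i)
    ... | yes j<c = ≼-respʳ-≈ (sym (ind (dec-true (j ℕ.<? column-at (suc i)) j<c)))
          (Σ<-indicator≼1 n (λ l → M̂ i (j ℕ.+ l)) (λ {k} {l} h h′ → ℕ.+-cancelˡ-≡ j k l (M̂-row {i} h h′)))
    ... | no j≮c = ≼-respʳ-≈ (sym (ind (dec-false (j ℕ.<? column-at (suc i)) j≮c)))
          (≼-reflexive (Σ<-zero n (λ l _ → ind (empty l))))
      where
      empty : ∀ l → M̂ i (j ℕ.+ l) ≡ false
      empty l with M̂ i (j ℕ.+ l) in eq
      ... | false = ≡.refl
      ... | true  = ⊥-elim (j≮c (ℕ.≤-<-trans (ℕ.m≤m+n j l) (support i eq)))

-- The orbitope lies in the projection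

module _ {c ℓ₁ ℓ₂} (K : OrderedField c ℓ₁ ℓ₂) {p q : ℕ} (q≤p : q ℕ.≤ p) where
  open OrderedFieldProperties K
  open Polyhedra K
  open FiniteSums K

  -- The flow is the combination of the path flows of the given matrices with the given weights, so
  -- each constraint reduces to its instances for single matrices.
  orbitope⊆polytope : ∀ {x} → packingOrbitope p q x → projection (extendedPolytope p q q≤p) x
  orbitope⊆polytope {x} (n , μ , z , 0≼μ , Σμ , z∈ , x≈) =
    y , (nonNegative , conserved , unit-out) , diag≼x , bar≼
    where
    module V (k : Fin n) = Vertex K q≤p (proj₁ (z∈ k)) (proj₁ (proj₂ (z∈ k))) (proj₁ (proj₂ (proj₂ (z∈ k))))

    w : Fin n → Point (Arc p q)
    w k = V.pathFlow k

    v : Fin n → Point (ℐ p q)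
    v k = entries p q (proj₁ (z∈ k))

    y : Point (Arc p q)
    y a = sum (λ k → μ k * w k a)

    x≈v : ∀ e → x e ≈ sum (λ k → μ k * v k e)
    x≈v e = trans (x≈ e) (sum-cong-≋ (λ k → *-congˡ (proj₂ (proj₂ (proj₂ (z∈ k))) e)))

    nonNegative : ∀ a → 0# ≼ y a
    nonNegative a = sum-nonNegative (λ k → *-nonNegative (0≼μ k) (proj₁ (V.pathFlow-unit k) a))

    conserved : ∀ u → u ≢ s → u ≢ t → inflow p q q≤p y u ≈ outflow p q q≤p y u
    conserved u u≢s u≢t = begin
      inflow p q q≤p y u                      ≈⟨ sumOver-linear (arc-finite p q) (λ a → arcHead a ≟-node u) μ w ⟩
      sum (λ k → μ k * inflow p q q≤p (w k) u)
        ≈⟨ sum-cong-≋ (λ k → *-congˡ (proj₁ (proj₂ (V.pathFlow-unit k)) u u≢s u≢t)) ⟩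
      sum (λ k → μ k * outflow p q q≤p (w k) u)
        ≈⟨ sumOver-linear (arc-finite p q) (λ a → arcTail q≤p a ≟-node u) μ w ⟨
      outflow p q q≤p y u                     ∎
      where open ≈-Reasoning

    unit-out : outflow p q q≤p y s ≈ 1#
    unit-out = begin
      outflow p q q≤p y s                        ≈⟨ sumOver-linear (arc-finite p q) (λ a → arcTail q≤p a ≟-node s) μ w ⟩
      sum (λ k → μ k * outflow p q q≤p (w k) s)
        ≈⟨ sum-cong-≋ (λ k → trans (*-congˡ (proj₂ (proj₂ (V.pathFlow-unit k)))) (*-identityʳ (μ k))) ⟩
      sum μ                                      ≈⟨ Σμ ⟩
      1#                                         ∎
      where open ≈-Reasoning

    diag≼x : ∀ e → y (diag e) ≼ x e
    diag≼x e = ≼-respʳ-≈ (sym (x≈v e)) (sum-mono-≼ (λ k → *-monoˡ-≼ (0≼μ k) (V.diag≼entry k e)))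

    bar≼ : ∀ e → sumOver (staircase-finite p q) (bar? e) x ≼ sumOver (arc-finite p q) (in↘? q≤p (colNodes? e)) y
    bar≼ e = begin
      sumOver (staircase-finite p q) (bar? e) x
        ≈⟨ sumOver-cong (staircase-finite p q) (bar? e) x≈v ⟩
      sumOver (staircase-finite p q) (bar? e) (λ f → sum (λ k → μ k * v k f))
        ≈⟨ sumOver-linear (staircase-finite p q) (bar? e) μ v ⟩
      sum (λ k → μ k * sumOver (staircase-finite p q) (bar? e) (v k))
        ≤⟨ sum-mono-≼ (λ k → *-monoˡ-≼ (0≼μ k) (V.bar≼in k e)) ⟩
      sum (λ k → μ k * sumOver (arc-finite p q) (in↘? q≤p (colNodes? e)) (w k))
        ≈⟨ sumOver-linear (arc-finite p q) (in↘? q≤p (colNodes? e)) μ w ⟨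
      sumOver (arc-finite p q) (in↘? q≤p (colNodes? e)) y  ∎
      where open ≼-Reasoning

theorem6 : ∀ {c ℓ₁ ℓ₂} (K : OrderedField c ℓ₁ ℓ₂) (p q : ℕ) → 1 ≤ q → (q≤p : q ≤ p) →
    let open Polyhedra K in
    packingOrbitope p q ≐ projection (extendedPolytope p q q≤p)
theorem6 K p q _ q≤p = orbitope⊆polytope K q≤p , polytope⊆orbitope K q≤p
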